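{- The Dynamic Calculus for EAK, as defined in the context (with or without the Grishin rules), enjoys cut elimination and the subformula property: every sequent derivable in the Dynamic Calculus has a derivation in the Dynamic Calculus containing no application of any of the four cut rules, and in which every operational term that occurs is a subterm of some operational term occurring in the end sequent.
   Context: **The Dynamic Calculus.** Notation: an inference is written "premises / conclusion"; "//" marks a rule applicable in both directions. Hatted symbols are structural connectives, unhatted ones operational connectives, and symbols with a tilde are structural connectives called virtual adjoints. *Operational terms.* There are four pairwise disjoint types $\mathsf{Fm},\mathsf{Fnc},\mathsf{Act},\mathsf{Ag}$. Given sets of atomic propositions $p$, of atomic functional actions $\alpha$ and of atomic agents $\mathtt a$: the terms of type $\mathsf{Fnc}$ are the atoms $\alpha$; the terms of type $\mathsf{Ag}$ are the atoms $\mathtt a$; the terms of type $\mathsf{Act}$ are $\gamma ::= \mathtt a\blacktriangle_3\alpha\mid \mathtt a\vartriangle_3\alpha$; the terms of type $\mathsf{Fm}$ are $A::= p\mid\bot\mid\top\mid A\wedge A\mid A\vee A\mid A\to A\mid A\leftarrow A\mid A\succ A\mid A\prec A\mid \alpha\,\sharp_0 A\mid\gamma\,\sharp_1 A\mid\mathtt a\,\sharp_2 A$, where $\sharp\in\{\vartriangle,\blacktriangle,\vartriangleright,\blacktriangleright\}$. *Structures.* The types $\mathsf{FM}\ni X$, $\mathsf{FNC}\ni F$, $\mathsf{ACT}\ni\Gamma$, $\mathsf{AG}\ni\mathbf a$ are defined by simultaneous recursion: $X::=A\mid \mathrm I\mid X;X\mid X>X\mid X<X\mid F\,\hat\sharp_0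 X\mid\Gamma\,\hat\sharp_1X\mid\mathbf a\,\hat\sharp_2X$ with $\hat\sharp\in\{\hat\vartriangle,\hat\blacktriangle,\hat\vartriangleright,\hat\blacktriangleright\}$; $F::=\alpha\mid X\tilde\vartriangleleft_0X\mid X\tilde\blacktriangleleft_0X\mid\mathbf a\,\tilde\vartriangleright_3\Gamma\mid\mathbf a\,\tilde\blacktriangleright_3\Gamma$; $\Gamma::=\gamma\mid\mathbf a\,\hat\blacktriangle_3F\mid\mathbf a\,\hat\vartriangle_3F\mid X\hat\vartriangleleft_1X\mid X\hat\blacktriangleleft_1X$; $\mathbf a::=\mathtt a\mid X\tilde\vartriangleleft_2X\mid X\tilde\blacktriangleleft_2X\mid\Gamma\tilde\vartriangleleft_3F\mid\Gamma\tilde\blacktriangleleft_3F$. Sequents have the form $x\vdash y$ with $x,y$ structures. Below $X,Y,Z,W$ are of type $\mathsf{FM}$; $A,B$ of type $\mathsf{Fm}$; $x,y,z$ are structures and $a,b$ operational terms of the type making the expression well formed. *Axioms.* $\mathtt a\vdash\mathtt a$; $\alpha\vdash\alpha$; $\bot\vdash\mathrm I$; $\mathrm I\vdash\top$; and *atom*: $F_1\circ_1(F_2\circ_2\cdots(F_n\circ_n p)\cdots)\vdash G_1\rhd_1(G_2\rhd_2\cdots(G_m\rhd_m p)\cdots)$ for $n,m\ge0$, $F_i,G_j\in\mathsf{FNC}$, $\circ_i\in\{\hat\vartriangle_0,\hat\blacktriangle_0\}$, $\rhd_j\in\{\hat\vartriangleright_0,\hat\blacktriangleright_0\}$ (in particular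 $p\vdash p$). *Cut rules* (one per type): $x\vdash a,\ a\vdash y\ /\ x\vdash y$, with $x,a,y$ all of the same type (agents, functional actions, actions, or formulas). *Propositional structural rules.* $X\vdash Y\ //\ \mathrm I\vdash Y<X$; $X\vdash Y\ //\ X<Y\vdash\mathrm I$; $X\vdash Y\ //\ \mathrm I\vdash X>Y$; $X\vdash Y\ //\ Y>X\vdash\mathrm I$; $\mathrm I\vdash X\ /\ Y\vdash X$; $X\vdash\mathrm I\ /\ X\vdash Y$; $X\vdash Z\ /\ Y\vdash Z<X$; $X\vdash Z\ /\ X<Z\vdash Y$; $X\vdash Z\ /\ Y\vdash X>Z$; $X\vdash Z\ /\ Z>X\vdash Y$; $X;X\vdash Y\ /\ X\vdash Y$; $Y\vdash X;X\ /\ Y\vdash X$; $Y;X\vdash Z\ /\ X;Y\vdash Z$; $Z\vdash X;Y\ /\ Z\vdash Y;X$; $X;(Y;Z)\vdash W\ /\ (X;Y);Z\vdash W$; $W\vdash(Z;Y);X\ /\ W\vdash Z;(Y;X)$. Display postulates: $X;Y\vdash Z\ //\ X\vdash Z<Y$; $Z\vdash X;Y\ //\ Z<Y\vdash X$; $X;Y\vdash Z\ //\ Y\vdash X>Z$; $Z\vdash X;Y\ //\ X>Z\vdash Y$. Grishin rules (added to obtain the classical base): $X>(Y;Z)\vdash W\ //\ (X>Y);Z\vdash W$; $W\vdash X>(Y;Z)\ //\ W\vdash(X>Y);Z$. *Propositional operational rules.* $X\vdash\mathrm I\ /\ X\vdash\bot$; $\mathrm I\vdash X\ /\ \top\vdash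 X$; $A;B\vdash Z\ /\ A\wedge B\vdash Z$; $X\vdash A,\ Y\vdash B\ /\ X;Y\vdash A\wedge B$; $A\vdash X,\ B\vdash Y\ /\ A\vee B\vdash X;Y$; $Z\vdash A;B\ /\ Z\vdash A\vee B$; $B\vdash Y,\ X\vdash A\ /\ B\leftarrow A\vdash Y<X$; $Z\vdash B<A\ /\ Z\vdash B\leftarrow A$; $B<A\vdash Z\ /\ B\prec A\vdash Z$; $Y\vdash B,\ A\vdash X\ /\ Y<X\vdash B\prec A$; $X\vdash A,\ B\vdash Y\ /\ A\to B\vdash X>Y$; $Z\vdash A>B\ /\ Z\vdash A\to B$; $A>B\vdash Z\ /\ A\succ B\vdash Z$; $A\vdash X,\ Y\vdash B\ /\ X>Y\vdash A\succ B$. *Heterogeneous operational rules.* For $0\le i\le3$ and $\sharp\in\{\vartriangle,\blacktriangle\}$: $a\,\hat\sharp_i\,b\vdash z\ /\ a\,\sharp_i\,b\vdash z$; $x\vdash a,\ y\vdash b\ /\ x\,\hat\sharp_i\,y\vdash a\,\sharp_i\,b$. For $0\le i\le2$ and $\sharp\in\{\vartriangleright,\blacktriangleright\}$: $x\vdash a,\ B\vdash Y\ /\ a\,\sharp_iB\vdash x\,\hat\sharp_iY$; $Z\vdash a\,\hat\sharp_iB\ /\ Z\vdash a\,\sharp_iB$. *Heterogeneous display postulates.* For $0\le i\le2$: $x\hat\vartriangle_iy\vdash z\ //\ y\vdash x\hat\blacktriangleright_iz$; $x\hat\blacktriangle_iy\vdash z\ //\ y\vdash x\hat\vartriangleright_iz$.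 For $i=1$: $x\hat\vartriangle_1y\vdash z\ //\ x\vdash z\hat\blacktriangleleft_1y$; $x\hat\blacktriangle_1y\vdash z\ //\ x\vdash z\hat\vartriangleleft_1y$. For $i\in\{0,2,3\}$: $x\hat\vartriangle_iy\vdash z\ //\ x\vdash z\tilde\blacktriangleleft_iy$; $x\hat\blacktriangle_iy\vdash z\ //\ x\vdash z\tilde\vartriangleleft_iy$. For $i=3$: $x\hat\vartriangle_3y\vdash z\ //\ y\vdash x\tilde\blacktriangleright_3z$; $x\hat\blacktriangle_3y\vdash z\ //\ y\vdash x\tilde\vartriangleright_3z$. *Necessitation, conjugation, Fischer Servi, monotonicity*, for $0\le i\le2$: $\mathrm I\vdash W\ /\ x\hat\vartriangle_i\mathrm I\vdash W$; $\mathrm I\vdash W\ /\ x\hat\blacktriangle_i\mathrm I\vdash W$; $W\vdash\mathrm I\ /\ W\vdash x\hat\vartriangleright_i\mathrm I$; $W\vdash\mathrm I\ /\ W\vdash x\hat\blacktriangleright_i\mathrm I$; $x\hat\vartriangle_i((x\hat\blacktriangle_iY);Z)\vdash W\ /\ Y;(x\hat\vartriangle_iZ)\vdash W$; $x\hat\blacktriangle_i((x\hat\vartriangle_iY);Z)\vdash W\ /\ Y;(x\hat\blacktriangle_iZ)\vdash W$; $W\vdash x\hat\vartriangleright_i((x\hat\blacktriangleright_iY);Z)\ /\ W\vdash Y;(x\hat\vartriangleright_iZ)$; $W\vdash x\hat\blacktriangleright_i((x\hat\vartriangleright_iY);Z)\ /\ W\vdash Y;(x\hat\blacktriangleright_iZ)$;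 $(x\hat\vartriangleright_iY)>(x\hat\vartriangle_iZ)\vdash W\ /\ x\hat\vartriangle_i(Y>Z)\vdash W$; $(x\hat\blacktriangleright_iY)>(x\hat\blacktriangle_iZ)\vdash W\ /\ x\hat\blacktriangle_i(Y>Z)\vdash W$; $W\vdash(x\hat\vartriangle_iY)>(x\hat\vartriangleright_iZ)\ /\ W\vdash x\hat\vartriangleright_i(Y>Z)$; $W\vdash(x\hat\blacktriangle_iY)>(x\hat\blacktriangleright_iZ)\ /\ W\vdash x\hat\blacktriangleright_i(Y>Z)$; $(x\hat\vartriangle_iY);(x\hat\vartriangle_iZ)\vdash W\ /\ x\hat\vartriangle_i(Y;Z)\vdash W$; $(x\hat\blacktriangle_iY);(x\hat\blacktriangle_iZ)\vdash W\ /\ x\hat\blacktriangle_i(Y;Z)\vdash W$; $W\vdash(x\hat\vartriangleright_iY);(x\hat\vartriangleright_iZ)\ /\ W\vdash x\hat\vartriangleright_i(Y;Z)$; $W\vdash(x\hat\blacktriangleright_iY);(x\hat\blacktriangleright_iZ)\ /\ W\vdash x\hat\blacktriangleright_i(Y;Z)$. *Interaction rules.* swap-out: $(\mathbf a\hat\blacktriangle_3F)\hat\blacktriangle_1(\mathbf a\hat\blacktriangle_2X)\vdash Y\ /\ \mathbf a\hat\blacktriangle_2(F\hat\blacktriangle_0X)\vdash Y$; $X\vdash(\mathbf a\hat\blacktriangle_3F)\hat\blacktriangleright_1(\mathbf a\hat\blacktriangleright_2Y)\ /\ X\vdash\mathbf a\hat\blacktriangleright_2(F\hat\blacktriangleright_0Y)$.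 swap-in: $\mathbf a\hat\blacktriangle_2(F\hat\blacktriangle_0X)\vdash Y\ /\ (\mathbf a\hat\blacktriangle_3F)\hat\blacktriangle_1(\mathbf a\hat\blacktriangle_2((F\hat\vartriangle_0\mathrm I);X))\vdash Y$; $X\vdash\mathbf a\hat\blacktriangleright_2(F\hat\blacktriangleright_0Y)\ /\ X\vdash(\mathbf a\hat\blacktriangle_3F)\hat\blacktriangleright_1(\mathbf a\hat\blacktriangleright_2((F\hat\vartriangle_0\mathrm I)>Y))$. balance: $X\vdash Y\ /\ F\hat\vartriangle_0X\vdash F\hat\vartriangleright_0Y$, for $F\in\mathsf{FNC}$. -}

module Defs where

open import Data.Bool using (Bool; true)
open import Data.Product using (Σ-syntax; _×_)
open import Data.Sum using (_⊎_)
open import Relation.Binary.PropositionalEquality using (_≡_)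

data Ty : Set where
  Fm Fnc Act Ag : Ty

-- The subscripts 0,…,3 of the heterogeneous connectives.  Idx l r o contains
-- the subscript i for which △ᵢ and ▲ᵢ take a left argument of type l and a
-- right argument of type r to a result of type o.  Hence Idx l Fm Fm is the
-- range 0 ≤ i ≤ 2, and  ∀ {l r o} (i : Idx l r o) → …  ranges over 0 ≤ i ≤ 3.
data Idx : Ty → Ty → Ty → Set where
  i0 : Idx Fnc Fm Fm
  i1 : Idx Act Fm Fm
  i2 : Idx Ag  Fm Fm
  i3 : Idx Ag  Fnc Act

module DynamicCalculus (AtProp AtFnc AtAg : Set) where

  infix  9 _△⟨_⟩_ _▲⟨_⟩_ _▷⟨_⟩_ _▶⟨_⟩_
  infix  9 _△^⟨_⟩_ _▲^⟨_⟩_ _▷^⟨_⟩_ _▶^⟨_⟩_ _◁^⟨_⟩_ _◀^⟨_⟩_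
  infix  8 _∧_ _∨_ _⇒_ _⇐_ _≻_ _≺_
  infix  8 _⨾_ _>_ _<_
  infix  6 _⊢_

  data Term : Ty → Set where
    prop : AtProp → Term Fm
    fnc  : AtFnc  → Term Fnc
    agt  : AtAg   → Term Ag
    ⊥ᶠ ⊤ᶠ : Term Fm
    -- ⇒, ⇐, ≻, ≺ are the paper's →, ←, ≻, ≺.
    _∧_ _∨_ _⇒_ _⇐_ _≻_ _≺_ : Term Fm → Term Fm → Term Fm
    _△⟨_⟩_ _▲⟨_⟩_ : ∀ {l r o} → Term l → Idx l r o → Term r → Term o
    _▷⟨_⟩_ _▶⟨_⟩_ : ∀ {l} → Term l → Idx l Fm Fm → Term Fm → Term Fm

  -- Structural connectives carry ^ , both when they are hatted (proper) and
  -- when they carry a tilde (virtual adjoints): for each shape and subscript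
  -- there is exactly one structural connective, so the accent is redundant.
  -- The tilde ones are ◁ᵢ, ◀ᵢ for i = 0,2,3 and ▷₃, ▶₃; the hatted ones are
  -- △ᵢ, ▲ᵢ for all i, ▷ᵢ, ▶ᵢ for i = 0,1,2, and ◁₁, ◀₁.
  data Str : Ty → Set where
    ⌜_⌝ : ∀ {t} → Term t → Str t
    I   : Str Fm
    _⨾_ _>_ _<_ : Str Fm → Str Fm → Str Fm
    _△^⟨_⟩_ _▲^⟨_⟩_ : ∀ {l r o} → Str l → Idx l r o → Str r → Str o
    _▷^⟨_⟩_ _▶^⟨_⟩_ : ∀ {l r o} → Str l → Idx l r o → Str o → Str r
    _◁^⟨_⟩_ _◀^⟨_⟩_ : ∀ {l r o} → Str o → Idx l r o → Str r → Str l

  -- Every axiom relates structures of one type and every rule preserves this,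
  -- so only type-uniform sequents are considered.
  data Sequent : Set where
    _⊢_ : ∀ {t} → Str t → Str t → Sequent

  -- F₁ ∘₁ (F₂ ∘₂ ⋯ (Fₙ ∘ₙ p)⋯) with each ∘ᵢ one of △₀, ▲₀
  data AtomL (p : AtProp) : Str Fm → Set where
    base : AtomL p ⌜ prop p ⌝
    △    : ∀ {F X} → AtomL p X → AtomL p (F △^⟨ i0 ⟩ X)
    ▲    : ∀ {F X} → AtomL p X → AtomL p (F ▲^⟨ i0 ⟩ X)

  -- G₁ ▹₁ (G₂ ▹₂ ⋯ (Gₘ ▹ₘ p)⋯) with each ▹ⱼ one of ▷₀, ▶₀
  data AtomR (p : AtProp) : Str Fm → Set where
    base : AtomR p ⌜ prop p ⌝
    ▷    : ∀ {G X} → AtomR p X → AtomR p (G ▷^⟨ i0 ⟩ X)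
    ▶    : ∀ {G X} → AtomR p X → AtomR p (G ▶^⟨ i0 ⟩ X)

  data Axiom : Sequent → Set where
    agt-ax : ∀ {a} → Axiom (⌜ agt a ⌝ ⊢ ⌜ agt a ⌝)
    fnc-ax : ∀ {α} → Axiom (⌜ fnc α ⌝ ⊢ ⌜ fnc α ⌝)
    ⊥-ax   : Axiom (⌜ ⊥ᶠ ⌝ ⊢ I)
    ⊤-ax   : Axiom (I ⊢ ⌜ ⊤ᶠ ⌝)
    atom   : ∀ {p X Y} → AtomL p X → AtomR p Y → Axiom (X ⊢ Y)

  infix 4 _/ˢ_ _//_ _//ᴳ_ _/ᵒ_ _,_/ᵒ_

  private variable
    l r o : Ty
    W X Y Z : Str Fm
    A B : Term Fm

  -- One-premise structural rules applicable from premise to conclusion only.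
  data _/ˢ_ : Sequent → Sequent → Set where
    I-weakL : I ⊢ X /ˢ Y ⊢ X
    I-weakR : X ⊢ I /ˢ X ⊢ Y
    weak<R  : X ⊢ Z /ˢ Y ⊢ Z < X
    weak<L  : X ⊢ Z /ˢ X < Z ⊢ Y
    weak>R  : X ⊢ Z /ˢ Y ⊢ X > Z
    weak>L  : X ⊢ Z /ˢ Z > X ⊢ Y
    contrL  : X ⨾ X ⊢ Y /ˢ X ⊢ Y
    contrR  : Y ⊢ X ⨾ X /ˢ Y ⊢ X
    exchL   : Y ⨾ X ⊢ Z /ˢ X ⨾ Y ⊢ Z
    exchR   : Z ⊢ X ⨾ Y /ˢ Z ⊢ Y ⨾ X
    assocL  : X ⨾ (Y ⨾ Z) ⊢ W /ˢ (X ⨾ Y) ⨾ Z ⊢ W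
    assocR  : W ⊢ (Z ⨾ Y) ⨾ X /ˢ W ⊢ Z ⨾ (Y ⨾ X)

    nec△ : ∀ (i : Idx l Fm Fm) {x} → I ⊢ W /ˢ x △^⟨ i ⟩ I ⊢ W
    nec▲ : ∀ (i : Idx l Fm Fm) {x} → I ⊢ W /ˢ x ▲^⟨ i ⟩ I ⊢ W
    nec▷ : ∀ (i : Idx l Fm Fm) {x} → W ⊢ I /ˢ W ⊢ x ▷^⟨ i ⟩ I
    nec▶ : ∀ (i : Idx l Fm Fm) {x} → W ⊢ I /ˢ W ⊢ x ▶^⟨ i ⟩ I

    conj△ : ∀ (i : Idx l Fm Fm) {x} →
      x △^⟨ i ⟩ ((x ▲^⟨ i ⟩ Y) ⨾ Z) ⊢ W /ˢ Y ⨾ (x △^⟨ i ⟩ Z) ⊢ W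
    conj▲ : ∀ (i : Idx l Fm Fm) {x} →
      x ▲^⟨ i ⟩ ((x △^⟨ i ⟩ Y) ⨾ Z) ⊢ W /ˢ Y ⨾ (x ▲^⟨ i ⟩ Z) ⊢ W
    conj▷ : ∀ (i : Idx l Fm Fm) {x} →
      W ⊢ x ▷^⟨ i ⟩ ((x ▶^⟨ i ⟩ Y) ⨾ Z) /ˢ W ⊢ Y ⨾ (x ▷^⟨ i ⟩ Z)
    conj▶ : ∀ (i : Idx l Fm Fm) {x} →
      W ⊢ x ▶^⟨ i ⟩ ((x ▷^⟨ i ⟩ Y) ⨾ Z) /ˢ W ⊢ Y ⨾ (x ▶^⟨ i ⟩ Z)

    FS△ : ∀ (i : Idx l Fm Fm) {x} →
      (x ▷^⟨ i ⟩ Y) > (x △^⟨ i ⟩ Z) ⊢ W /ˢ x △^⟨ i ⟩ (Y > Z) ⊢ W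
    FS▲ : ∀ (i : Idx l Fm Fm) {x} →
      (x ▶^⟨ i ⟩ Y) > (x ▲^⟨ i ⟩ Z) ⊢ W /ˢ x ▲^⟨ i ⟩ (Y > Z) ⊢ W
    FS▷ : ∀ (i : Idx l Fm Fm) {x} →
      W ⊢ (x △^⟨ i ⟩ Y) > (x ▷^⟨ i ⟩ Z) /ˢ W ⊢ x ▷^⟨ i ⟩ (Y > Z)
    FS▶ : ∀ (i : Idx l Fm Fm) {x} →
      W ⊢ (x ▲^⟨ i ⟩ Y) > (x ▶^⟨ i ⟩ Z) /ˢ W ⊢ x ▶^⟨ i ⟩ (Y > Z)

    mon△ : ∀ (i : Idx l Fm Fm) {x} →
      (x △^⟨ i ⟩ Y) ⨾ (x △^⟨ i ⟩ Z) ⊢ W /ˢ x △^⟨ i ⟩ (Y ⨾ Z) ⊢ W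
    mon▲ : ∀ (i : Idx l Fm Fm) {x} →
      (x ▲^⟨ i ⟩ Y) ⨾ (x ▲^⟨ i ⟩ Z) ⊢ W /ˢ x ▲^⟨ i ⟩ (Y ⨾ Z) ⊢ W
    mon▷ : ∀ (i : Idx l Fm Fm) {x} →
      W ⊢ (x ▷^⟨ i ⟩ Y) ⨾ (x ▷^⟨ i ⟩ Z) /ˢ W ⊢ x ▷^⟨ i ⟩ (Y ⨾ Z)
    mon▶ : ∀ (i : Idx l Fm Fm) {x} →
      W ⊢ (x ▶^⟨ i ⟩ Y) ⨾ (x ▶^⟨ i ⟩ Z) /ˢ W ⊢ x ▶^⟨ i ⟩ (Y ⨾ Z)

    swap-outL : ∀ {a F} →
      (a ▲^⟨ i3 ⟩ F) ▲^⟨ i1 ⟩ (a ▲^⟨ i2 ⟩ X) ⊢ Y /ˢ a ▲^⟨ i2 ⟩ (F ▲^⟨ i0 ⟩ X) ⊢ Y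
    swap-outR : ∀ {a F} →
      X ⊢ (a ▲^⟨ i3 ⟩ F) ▶^⟨ i1 ⟩ (a ▶^⟨ i2 ⟩ Y) /ˢ X ⊢ a ▶^⟨ i2 ⟩ (F ▶^⟨ i0 ⟩ Y)
    swap-inL : ∀ {a F} →
      a ▲^⟨ i2 ⟩ (F ▲^⟨ i0 ⟩ X) ⊢ Y
      /ˢ (a ▲^⟨ i3 ⟩ F) ▲^⟨ i1 ⟩ (a ▲^⟨ i2 ⟩ ((F △^⟨ i0 ⟩ I) ⨾ X)) ⊢ Y
    swap-inR : ∀ {a F} →
      X ⊢ a ▶^⟨ i2 ⟩ (F ▶^⟨ i0 ⟩ Y)
      /ˢ X ⊢ (a ▲^⟨ i3 ⟩ F) ▶^⟨ i1 ⟩ (a ▶^⟨ i2 ⟩ ((F △^⟨ i0 ⟩ I) > Y))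
    balance : ∀ {F} → X ⊢ Y /ˢ F △^⟨ i0 ⟩ X ⊢ F ▷^⟨ i0 ⟩ Y

  -- Structural rules applicable in both directions, Grishin rules excepted.
  data _//_ : Sequent → Sequent → Set where
    I<R : X ⊢ Y // I ⊢ Y < X
    I<L : X ⊢ Y // X < Y ⊢ I
    I>R : X ⊢ Y // I ⊢ X > Y
    I>L : X ⊢ Y // Y > X ⊢ I

    disp⨾<L : X ⨾ Y ⊢ Z // X ⊢ Z < Y
    disp⨾<R : Z ⊢ X ⨾ Y // Z < Y ⊢ X
    disp⨾>L : X ⨾ Y ⊢ Z // Y ⊢ X > Z
    disp⨾>R : Z ⊢ X ⨾ Y // X > Z ⊢ Y

    disp△▶ : ∀ (i : Idx l r o) {x y z} → x △^⟨ i ⟩ y ⊢ z // y ⊢ x ▶^⟨ i ⟩ z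
    disp▲▷ : ∀ (i : Idx l r o) {x y z} → x ▲^⟨ i ⟩ y ⊢ z // y ⊢ x ▷^⟨ i ⟩ z
    disp△◀ : ∀ (i : Idx l r o) {x y z} → x △^⟨ i ⟩ y ⊢ z // x ⊢ z ◀^⟨ i ⟩ y
    disp▲◁ : ∀ (i : Idx l r o) {x y z} → x ▲^⟨ i ⟩ y ⊢ z // x ⊢ z ◁^⟨ i ⟩ y

  data _//ᴳ_ : Sequent → Sequent → Set where
    grishinL : X > (Y ⨾ Z) ⊢ W //ᴳ (X > Y) ⨾ Z ⊢ W
    grishinR : W ⊢ X > (Y ⨾ Z) //ᴳ W ⊢ (X > Y) ⨾ Z

  -- One-premise operational rules.
  data _/ᵒ_ : Sequent → Sequent → Set where
    ⊥R : X ⊢ I /ᵒ X ⊢ ⌜ ⊥ᶠ ⌝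
    ⊤L : I ⊢ X /ᵒ ⌜ ⊤ᶠ ⌝ ⊢ X
    ∧L : ⌜ A ⌝ ⨾ ⌜ B ⌝ ⊢ Z /ᵒ ⌜ A ∧ B ⌝ ⊢ Z
    ∨R : Z ⊢ ⌜ A ⌝ ⨾ ⌜ B ⌝ /ᵒ Z ⊢ ⌜ A ∨ B ⌝
    ⇐R : Z ⊢ ⌜ B ⌝ < ⌜ A ⌝ /ᵒ Z ⊢ ⌜ B ⇐ A ⌝
    ≺L : ⌜ B ⌝ < ⌜ A ⌝ ⊢ Z /ᵒ ⌜ B ≺ A ⌝ ⊢ Z
    ⇒R : Z ⊢ ⌜ A ⌝ > ⌜ B ⌝ /ᵒ Z ⊢ ⌜ A ⇒ B ⌝
    ≻L : ⌜ A ⌝ > ⌜ B ⌝ ⊢ Z /ᵒ ⌜ A ≻ B ⌝ ⊢ Z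

    △L : ∀ (i : Idx l r o) {a b z} → ⌜ a ⌝ △^⟨ i ⟩ ⌜ b ⌝ ⊢ z /ᵒ ⌜ a △⟨ i ⟩ b ⌝ ⊢ z
    ▲L : ∀ (i : Idx l r o) {a b z} → ⌜ a ⌝ ▲^⟨ i ⟩ ⌜ b ⌝ ⊢ z /ᵒ ⌜ a ▲⟨ i ⟩ b ⌝ ⊢ z
    ▷R : ∀ (i : Idx l Fm Fm) {a} → Z ⊢ ⌜ a ⌝ ▷^⟨ i ⟩ ⌜ B ⌝ /ᵒ Z ⊢ ⌜ a ▷⟨ i ⟩ B ⌝
    ▶R : ∀ (i : Idx l Fm Fm) {a} → Z ⊢ ⌜ a ⌝ ▶^⟨ i ⟩ ⌜ B ⌝ /ᵒ Z ⊢ ⌜ a ▶⟨ i ⟩ B ⌝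

  -- Two-premise operational rules.
  data _,_/ᵒ_ : Sequent → Sequent → Sequent → Set where
    ∧R : X ⊢ ⌜ A ⌝ , Y ⊢ ⌜ B ⌝ /ᵒ X ⨾ Y ⊢ ⌜ A ∧ B ⌝
    ∨L : ⌜ A ⌝ ⊢ X , ⌜ B ⌝ ⊢ Y /ᵒ ⌜ A ∨ B ⌝ ⊢ X ⨾ Y
    ⇐L : ⌜ B ⌝ ⊢ Y , X ⊢ ⌜ A ⌝ /ᵒ ⌜ B ⇐ A ⌝ ⊢ Y < X
    ≺R : Y ⊢ ⌜ B ⌝ , ⌜ A ⌝ ⊢ X /ᵒ Y < X ⊢ ⌜ B ≺ A ⌝
    ⇒L : X ⊢ ⌜ A ⌝ , ⌜ B ⌝ ⊢ Y /ᵒ ⌜ A ⇒ B ⌝ ⊢ X > Y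
    ≻R : ⌜ A ⌝ ⊢ X , Y ⊢ ⌜ B ⌝ /ᵒ X > Y ⊢ ⌜ A ≻ B ⌝

    △R : ∀ (i : Idx l r o) {a b x y} →
      x ⊢ ⌜ a ⌝ , y ⊢ ⌜ b ⌝ /ᵒ x △^⟨ i ⟩ y ⊢ ⌜ a △⟨ i ⟩ b ⌝
    ▲R : ∀ (i : Idx l r o) {a b x y} →
      x ⊢ ⌜ a ⌝ , y ⊢ ⌜ b ⌝ /ᵒ x ▲^⟨ i ⟩ y ⊢ ⌜ a ▲⟨ i ⟩ b ⌝
    ▷L : ∀ (i : Idx l Fm Fm) {a x} →
      x ⊢ ⌜ a ⌝ , ⌜ B ⌝ ⊢ Y /ᵒ ⌜ a ▷⟨ i ⟩ B ⌝ ⊢ x ▷^⟨ i ⟩ Y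
    ▶L : ∀ (i : Idx l Fm Fm) {a x} →
      x ⊢ ⌜ a ⌝ , ⌜ B ⌝ ⊢ Y /ᵒ ⌜ a ▶⟨ i ⟩ B ⌝ ⊢ x ▶^⟨ i ⟩ Y

  -- Derivations; the Grishin rules are available when g ≡ true.
  data Der (g : Bool) : Sequent → Set where
    axiom     : ∀ {S} → Axiom S → Der g S
    cut       : ∀ {t} {x y : Str t} (a : Term t) →
                Der g (x ⊢ ⌜ a ⌝) → Der g (⌜ a ⌝ ⊢ y) → Der g (x ⊢ y)
    struct    : ∀ {S T} → S /ˢ T → Der g S → Der g T
    struct↓   : ∀ {S T} → S // T → Der g S → Der g T
    struct↑   : ∀ {S T} → S // T → Der g T → Der g S
    grishin↓  : ∀ {S T} → g ≡ true → S //ᴳ T → Der g S → Der g T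
    grishin↑  : ∀ {S T} → g ≡ true → S //ᴳ T → Der g T → Der g S
    logic₁    : ∀ {S T} → S /ᵒ T → Der g S → Der g T
    logic₂    : ∀ {S₁ S₂ T} → S₁ , S₂ /ᵒ T → Der g S₁ → Der g S₂ → Der g T

  data CutFree {g} : ∀ {S} → Der g S → Set where
    axiom    : ∀ {S} {A : Axiom S} → CutFree (axiom A)
    struct   : ∀ {S T} {R : S /ˢ T} {d} → CutFree d → CutFree (struct R d)
    struct↓  : ∀ {S T} {R : S // T} {d} → CutFree d → CutFree (struct↓ R d)
    struct↑  : ∀ {S T} {R : S // T} {d} → CutFree d → CutFree (struct↑ R d)
    grishin↓ : ∀ {S T e} {R : S //ᴳ T} {d} → CutFree d → CutFree (grishin↓ e R d)
    grishin↑ : ∀ {S T e} {R : S //ᴳ T} {d} → CutFree d → CutFree (grishin↑ e R d)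
    logic₁   : ∀ {S T} {R : S /ᵒ T} {d} → CutFree d → CutFree (logic₁ R d)
    logic₂   : ∀ {S₁ S₂ T} {R : S₁ , S₂ /ᵒ T} {d e} →
               CutFree d → CutFree e → CutFree (logic₂ R d e)

  infix 4 _⊑_ _occursInStr_ _occursIn_ _appearsIn_

  data _⊑_ {s} (u : Term s) : ∀ {t} → Term t → Set where
    refl : u ⊑ u
    ∧ˡ : ∀ {A B} → u ⊑ A → u ⊑ A ∧ B
    ∧ʳ : ∀ {A B} → u ⊑ B → u ⊑ A ∧ B
    ∨ˡ : ∀ {A B} → u ⊑ A → u ⊑ A ∨ B
    ∨ʳ : ∀ {A B} → u ⊑ B → u ⊑ A ∨ B
    ⇒ˡ : ∀ {A B} → u ⊑ A → u ⊑ A ⇒ B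
    ⇒ʳ : ∀ {A B} → u ⊑ B → u ⊑ A ⇒ B
    ⇐ˡ : ∀ {A B} → u ⊑ A → u ⊑ A ⇐ B
    ⇐ʳ : ∀ {A B} → u ⊑ B → u ⊑ A ⇐ B
    ≻ˡ : ∀ {A B} → u ⊑ A → u ⊑ A ≻ B
    ≻ʳ : ∀ {A B} → u ⊑ B → u ⊑ A ≻ B
    ≺ˡ : ∀ {A B} → u ⊑ A → u ⊑ A ≺ B
    ≺ʳ : ∀ {A B} → u ⊑ B → u ⊑ A ≺ B
    △ˡ : ∀ {l r o} {i : Idx l r o} {a b} → u ⊑ a → u ⊑ a △⟨ i ⟩ b
    △ʳ : ∀ {l r o} {i : Idx l r o} {a b} → u ⊑ b → u ⊑ a △⟨ i ⟩ b
    ▲ˡ : ∀ {l r o} {i : Idx l r o} {a b} → u ⊑ a → u ⊑ a ▲⟨ i ⟩ b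
    ▲ʳ : ∀ {l r o} {i : Idx l r o} {a b} → u ⊑ b → u ⊑ a ▲⟨ i ⟩ b
    ▷ˡ : ∀ {l} {i : Idx l Fm Fm} {a B} → u ⊑ a → u ⊑ a ▷⟨ i ⟩ B
    ▷ʳ : ∀ {l} {i : Idx l Fm Fm} {a B} → u ⊑ B → u ⊑ a ▷⟨ i ⟩ B
    ▶ˡ : ∀ {l} {i : Idx l Fm Fm} {a B} → u ⊑ a → u ⊑ a ▶⟨ i ⟩ B
    ▶ʳ : ∀ {l} {i : Idx l Fm Fm} {a B} → u ⊑ B → u ⊑ a ▶⟨ i ⟩ B

  -- A term occurs in a structure also when it occurs inside a larger term.
  data _occursInStr_ {s} (u : Term s) : ∀ {t} → Str t → Set where
    leaf : ∀ {t} {a : Term t} → u ⊑ a → u occursInStr ⌜ a ⌝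
    ⨾ˡ : ∀ {X Y} → u occursInStr X → u occursInStr X ⨾ Y
    ⨾ʳ : ∀ {X Y} → u occursInStr Y → u occursInStr X ⨾ Y
    >ˡ : ∀ {X Y} → u occursInStr X → u occursInStr X > Y
    >ʳ : ∀ {X Y} → u occursInStr Y → u occursInStr X > Y
    <ˡ : ∀ {X Y} → u occursInStr X → u occursInStr X < Y
    <ʳ : ∀ {X Y} → u occursInStr Y → u occursInStr X < Y
    △ˡ : ∀ {l r o} {i : Idx l r o} {x y} → u occursInStr x → u occursInStr x △^⟨ i ⟩ y
    △ʳ : ∀ {l r o} {i : Idx l r o} {x y} → u occursInStr y → u occursInStr x △^⟨ i ⟩ y
    ▲ˡ : ∀ {l r o} {i : Idx l r o} {x y} → u occursInStr x → u occursInStr x ▲^⟨ i ⟩ y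
    ▲ʳ : ∀ {l r o} {i : Idx l r o} {x y} → u occursInStr y → u occursInStr x ▲^⟨ i ⟩ y
    ▷ˡ : ∀ {l r o} {i : Idx l r o} {x y} → u occursInStr x → u occursInStr x ▷^⟨ i ⟩ y
    ▷ʳ : ∀ {l r o} {i : Idx l r o} {x y} → u occursInStr y → u occursInStr x ▷^⟨ i ⟩ y
    ▶ˡ : ∀ {l r o} {i : Idx l r o} {x y} → u occursInStr x → u occursInStr x ▶^⟨ i ⟩ y
    ▶ʳ : ∀ {l r o} {i : Idx l r o} {x y} → u occursInStr y → u occursInStr x ▶^⟨ i ⟩ y
    ◁ˡ : ∀ {l r o} {i : Idx l r o} {x y} → u occursInStr x → u occursInStr x ◁^⟨ i ⟩ y
    ◁ʳ : ∀ {l r o} {i : Idx l r o} {x y} → u occursInStr y → u occursInStr x ◁^⟨ i ⟩ y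
    ◀ˡ : ∀ {l r o} {i : Idx l r o} {x y} → u occursInStr x → u occursInStr x ◀^⟨ i ⟩ y
    ◀ʳ : ∀ {l r o} {i : Idx l r o} {x y} → u occursInStr y → u occursInStr x ◀^⟨ i ⟩ y

  _occursIn_ : ∀ {s} → Term s → Sequent → Set
  u occursIn (x ⊢ y) = u occursInStr x ⊎ u occursInStr y

  data _appearsIn_ {g} (S : Sequent) : ∀ {T} → Der g T → Set where
    here      : {d : Der g S} → S appearsIn d
    cutˡ      : ∀ {t} {x y : Str t} {a} {d : Der g (x ⊢ ⌜ a ⌝)} {e : Der g (⌜ a ⌝ ⊢ y)} →
                S appearsIn d → S appearsIn cut a d e
    cutʳ      : ∀ {t} {x y : Str t} {a} {d : Der g (x ⊢ ⌜ a ⌝)} {e : Der g (⌜ a ⌝ ⊢ y)} →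
                S appearsIn e → S appearsIn cut a d e
    struct    : ∀ {T U} {R : T /ˢ U} {d} → S appearsIn d → S appearsIn struct R d
    struct↓   : ∀ {T U} {R : T // U} {d} → S appearsIn d → S appearsIn struct↓ R d
    struct↑   : ∀ {T U} {R : T // U} {d} → S appearsIn d → S appearsIn struct↑ R d
    grishin↓  : ∀ {T U e} {R : T //ᴳ U} {d} → S appearsIn d → S appearsIn grishin↓ e R d
    grishin↑  : ∀ {T U e} {R : T //ᴳ U} {d} → S appearsIn d → S appearsIn grishin↑ e R d
    logic₁    : ∀ {T U} {R : T /ᵒ U} {d} → S appearsIn d → S appearsIn logic₁ R d
    logic₂ˡ   : ∀ {T₁ T₂ U} {R : T₁ , T₂ /ᵒ U} {d e} →
                S appearsIn d → S appearsIn logic₂ R d e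
    logic₂ʳ   : ∀ {T₁ T₂ U} {R : T₁ , T₂ /ᵒ U} {d e} →
                S appearsIn e → S appearsIn logic₂ R d e

  HasSubtermProperty : ∀ {g T} → Der g T → Set
  HasSubtermProperty {T = T} d =
    ∀ {S} → S appearsIn d → ∀ {s} (u : Term s) → u occursIn S →
    Σ[ t ∈ Ty ] Σ[ v ∈ Term t ] (v occursIn T × u ⊑ v)

{-# OPTIONS --safe #-}

-- Cut elimination is Belnap's: trace the cut term upwards through the
-- derivation of x ⊢ a, replacing it by y until it becomes principal, then do
-- the same in the derivation of a ⊢ y, and split the remaining principal cut
-- into cuts on the immediate subterms.
-- The obstacle is that swap-in and balance duplicate parameters of types Ag and
-- Fnc in their conclusions, so a replacement might affect only one copy.
-- However, a heterogeneous connective on the side of the turnstile where no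
-- display postulate can open it stays closed in all further inferences, hence
-- the traced occurrences never lie inside one.  Since the duplicated parameters
-- are in antecedent position, where an Ag or Fnc structure is a term or such a
-- closed structure, only the replacement of terms of types Ag and Fnc could
-- separate the copies; but a cut on such a term is trivial, because a cut-free
-- x ⊢ a of these types is an axiom.

module Submission where

open import Defs
open import Data.Bool using (Bool; true)
open import Data.Empty using (⊥; ⊥-elim)
open import Data.Product using (Σ-syntax; _×_; _,_)
open import Data.Sum using (inj₁; inj₂)
open import Data.Unit using (⊤; tt)
open import Function using (_∘_)
open import Relation.Nullary using (¬_)
open import Relation.Binary.PropositionalEquality using (_≡_; refl; cong₂)

-- Rigid types and positions in a sequent.

-- The types whose structures are duplicated by swap-in and balance.
data Rigid : Ty → Set where
  fnc : Rigid Fnc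
  agt : Rigid Ag

-- Antecedent position, succedent position, and a position below a
-- heterogeneous connective that cannot be displayed.
data Position : Set where
  ant suc off : Position

opposite : Position → Position
opposite ant = suc
opposite suc = ant
opposite off = off

-- Display postulates open `△^` and `▲^` only in antecedent position and the other heterogeneous
-- connectives only in succedent position. Arguments found anywhere else get position `off`.
onlyAnt onlySuc : Position → Position
onlyAnt ant = ant
onlyAnt suc = off
onlyAnt off = off
onlySuc ant = off
onlySuc suc = suc
onlySuc off = off

module CutElimination (AtProp AtFnc AtAg : Set) (g : Bool) where

  open DynamicCalculus AtProp AtFnc AtAg

  private variable
    t l r o : Ty
    p : Position
    S T T′ S₁ S₂ : Sequent
    X Y : Str Fm
    x x′ y y′ z : Str t
    A B : Term Fm
    a b : Term t

  -- Cut-free derivations and principal inferences.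

  CutFreeDer : Sequent → Set
  CutFreeDer S = Σ[ d ∈ Der g S ] CutFree d

  ax : Axiom S → CutFreeDer S
  ax A = axiom A , axiom

  apply : S /ˢ T → CutFreeDer S → CutFreeDer T
  apply R (d , c) = struct R d , struct c

  apply↓ : S // T → CutFreeDer S → CutFreeDer T
  apply↓ R (d , c) = struct↓ R d , struct↓ c

  apply↑ : S // T → CutFreeDer T → CutFreeDer S
  apply↑ R (d , c) = struct↑ R d , struct↑ c

  apply₁ : S /ᵒ T → CutFreeDer S → CutFreeDer T
  apply₁ R (d , c) = logic₁ R d , logic₁ c

  apply₂ : S₁ , S₂ /ᵒ T → CutFreeDer S₁ → CutFreeDer S₂ → CutFreeDer T
  apply₂ R (d , c) (e , f) = logic₂ R d e , logic₂ c f

  -- What remains of a cut-free derivation whose last step introduces `a` on the right: its premises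
  -- or, for an atom, the shape of the left side of the axiom.
  data RightPrincipal : Term t → Str t → Set where
    atom : ∀ {p} → AtomL p X → RightPrincipal (prop p) X
    ⊤R : RightPrincipal ⊤ᶠ I
    ⊥R : CutFreeDer (X ⊢ I) → RightPrincipal ⊥ᶠ X
    ∧R : CutFreeDer (X ⊢ ⌜ A ⌝) → CutFreeDer (Y ⊢ ⌜ B ⌝) → RightPrincipal (A ∧ B) (X ⨾ Y)
    ∨R : CutFreeDer (X ⊢ ⌜ A ⌝ ⨾ ⌜ B ⌝) → RightPrincipal (A ∨ B) X
    ⇐R : CutFreeDer (X ⊢ ⌜ B ⌝ < ⌜ A ⌝) → RightPrincipal (B ⇐ A) X
    ⇒R : CutFreeDer (X ⊢ ⌜ A ⌝ > ⌜ B ⌝) → RightPrincipal (A ⇒ B) X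
    ≺R : CutFreeDer (Y ⊢ ⌜ B ⌝) → CutFreeDer (⌜ A ⌝ ⊢ X) → RightPrincipal (B ≺ A) (Y < X)
    ≻R : CutFreeDer (⌜ A ⌝ ⊢ X) → CutFreeDer (Y ⊢ ⌜ B ⌝) → RightPrincipal (A ≻ B) (X > Y)
    △R : {i : Idx l r o} → CutFreeDer (x ⊢ ⌜ a ⌝) → CutFreeDer (y ⊢ ⌜ b ⌝) →
         RightPrincipal (a △⟨ i ⟩ b) (x △^⟨ i ⟩ y)
    ▲R : {i : Idx l r o} → CutFreeDer (x ⊢ ⌜ a ⌝) → CutFreeDer (y ⊢ ⌜ b ⌝) →
         RightPrincipal (a ▲⟨ i ⟩ b) (x ▲^⟨ i ⟩ y)
    ▷R : {i : Idx l Fm Fm} → CutFreeDer (X ⊢ ⌜ a ⌝ ▷^⟨ i ⟩ ⌜ B ⌝) → RightPrincipal (a ▷⟨ i ⟩ B) X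
    ▶R : {i : Idx l Fm Fm} → CutFreeDer (X ⊢ ⌜ a ⌝ ▶^⟨ i ⟩ ⌜ B ⌝) → RightPrincipal (a ▶⟨ i ⟩ B) X

  data LeftPrincipal : Term t → Str t → Set where
    atom : ∀ {p} → AtomR p X → LeftPrincipal (prop p) X
    ⊤L : CutFreeDer (I ⊢ X) → LeftPrincipal ⊤ᶠ X
    ⊥L : LeftPrincipal ⊥ᶠ I
    ∧L : CutFreeDer (⌜ A ⌝ ⨾ ⌜ B ⌝ ⊢ X) → LeftPrincipal (A ∧ B) X
    ∨L : CutFreeDer (⌜ A ⌝ ⊢ X) → CutFreeDer (⌜ B ⌝ ⊢ Y) → LeftPrincipal (A ∨ B) (X ⨾ Y)
    ⇐L : CutFreeDer (⌜ B ⌝ ⊢ Y) → CutFreeDer (X ⊢ ⌜ A ⌝) → LeftPrincipal (B ⇐ A) (Y < X)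
    ⇒L : CutFreeDer (X ⊢ ⌜ A ⌝) → CutFreeDer (⌜ B ⌝ ⊢ Y) → LeftPrincipal (A ⇒ B) (X > Y)
    ≺L : CutFreeDer (⌜ B ⌝ < ⌜ A ⌝ ⊢ X) → LeftPrincipal (B ≺ A) X
    ≻L : CutFreeDer (⌜ A ⌝ > ⌜ B ⌝ ⊢ X) → LeftPrincipal (A ≻ B) X
    △L : {i : Idx l r o} → CutFreeDer (⌜ a ⌝ △^⟨ i ⟩ ⌜ b ⌝ ⊢ z) → LeftPrincipal (a △⟨ i ⟩ b) z
    ▲L : {i : Idx l r o} → CutFreeDer (⌜ a ⌝ ▲^⟨ i ⟩ ⌜ b ⌝ ⊢ z) → LeftPrincipal (a ▲⟨ i ⟩ b) z
    ▷L : {i : Idx l Fm Fm} → CutFreeDer (x ⊢ ⌜ a ⌝) → CutFreeDer (⌜ B ⌝ ⊢ Y) →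
         LeftPrincipal (a ▷⟨ i ⟩ B) (x ▷^⟨ i ⟩ Y)
    ▶L : {i : Idx l Fm Fm} → CutFreeDer (x ⊢ ⌜ a ⌝) → CutFreeDer (⌜ B ⌝ ⊢ Y) →
         LeftPrincipal (a ▶⟨ i ⟩ B) (x ▶^⟨ i ⟩ Y)

  -- Replacement of traced occurrences.

  -- `Replaces p a z` permits an occurrence of `a` in position `p` to become `z`. Abstracting over
  -- it lets one induction serve both passes of the cut elimination and the subterm property.
  -- `right` and `left` supply the derivation where a replaced term is principal; `oneSided` is for
  -- atom axioms, where both atoms could be replaced at once.
  record Replacement : Set₁ where
    field
      Replaces : Position → ∀ {t} → Term t → Str t → Set
      live     : ¬ Replaces off a z
      flexible : Rigid t → ¬ Replaces p {t} a z
      oneSided : Replaces suc a y → ¬ Replaces ant b x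
      right    : Replaces suc a y → RightPrincipal a x → CutFreeDer (x ⊢ y)
      left     : Replaces ant a x → LeftPrincipal a y → CutFreeDer (x ⊢ y)

  -- Q is a property of all terms occurring in the source of a replacement; it
  -- is trivial in the cut elimination and carries the subterm property.
  module Tracing (𝓡 : Replacement) (Q : ∀ {s} → Term s → Set) where

    open Replacement 𝓡

    infix 8 _⟨⨾⟩_ _⟨>⟩_ _⟨<⟩_ _⟨△⟩_ _⟨▲⟩_ _⟨▷⟩_ _⟨▶⟩_ _⟨◁⟩_ _⟨◀⟩_
    infix 6 _⟨⊢⟩_
    infix 4 _⟶_

    -- A relation rather than a function: each occurrence is kept or replaced separately, so
    -- untraced copies of the cut term stay. The evidence for `Q` concerns the source, not the
    -- inserted structure.
    data _∶_⇝_ : Position → ∀ {t} → Str t → Str t → Set where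
      keep : (∀ {s} {u : Term s} → u ⊑ a → Q u) → p ∶ ⌜ a ⌝ ⇝ ⌜ a ⌝
      repl : (∀ {s} {u : Term s} → u ⊑ a → Q u) → Replaces p a z → p ∶ ⌜ a ⌝ ⇝ z
      ⟨I⟩  : p ∶ I ⇝ I
      _⟨⨾⟩_ : ∀ {X X′ Y Y′} → p ∶ X ⇝ X′ → p ∶ Y ⇝ Y′ → p ∶ X ⨾ Y ⇝ (X′ ⨾ Y′)
      _⟨>⟩_ : ∀ {X X′ Y Y′} → opposite p ∶ X ⇝ X′ → p ∶ Y ⇝ Y′ → p ∶ X > Y ⇝ (X′ > Y′)
      _⟨<⟩_ : ∀ {X X′ Y Y′} → p ∶ X ⇝ X′ → opposite p ∶ Y ⇝ Y′ → p ∶ X < Y ⇝ (X′ < Y′)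
      _⟨△⟩_ : {i : Idx l r o} → onlyAnt p ∶ x ⇝ x′ → onlyAnt p ∶ y ⇝ y′ →
              p ∶ x △^⟨ i ⟩ y ⇝ (x′ △^⟨ i ⟩ y′)
      _⟨▲⟩_ : {i : Idx l r o} → onlyAnt p ∶ x ⇝ x′ → onlyAnt p ∶ y ⇝ y′ →
              p ∶ x ▲^⟨ i ⟩ y ⇝ (x′ ▲^⟨ i ⟩ y′)
      _⟨▷⟩_ : {i : Idx l r o} → opposite (onlySuc p) ∶ x ⇝ x′ → onlySuc p ∶ y ⇝ y′ →
              p ∶ x ▷^⟨ i ⟩ y ⇝ (x′ ▷^⟨ i ⟩ y′)
      _⟨▶⟩_ : {i : Idx l r o} → opposite (onlySuc p) ∶ x ⇝ x′ → onlySuc p ∶ y ⇝ y′ →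
              p ∶ x ▶^⟨ i ⟩ y ⇝ (x′ ▶^⟨ i ⟩ y′)
      _⟨◁⟩_ : {i : Idx l r o} → onlySuc p ∶ x ⇝ x′ → opposite (onlySuc p) ∶ y ⇝ y′ →
              p ∶ x ◁^⟨ i ⟩ y ⇝ (x′ ◁^⟨ i ⟩ y′)
      _⟨◀⟩_ : {i : Idx l r o} → onlySuc p ∶ x ⇝ x′ → opposite (onlySuc p) ∶ y ⇝ y′ →
              p ∶ x ◀^⟨ i ⟩ y ⇝ (x′ ◀^⟨ i ⟩ y′)

    data _⟶_ : Sequent → Sequent → Set where
      _⟨⊢⟩_ : ant ∶ x ⇝ x′ → suc ∶ y ⇝ y′ → (x ⊢ y) ⟶ (x′ ⊢ y′)

    ⇝-refl : (x : Str t) → (∀ {s} {u : Term s} → u occursInStr x → Q u) → p ∶ x ⇝ x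
    ⇝-refl ⌜ a ⌝          h = keep (h ∘ leaf)
    ⇝-refl I              h = ⟨I⟩
    ⇝-refl (x ⨾ y)        h = ⇝-refl x (h ∘ ⨾ˡ) ⟨⨾⟩ ⇝-refl y (h ∘ ⨾ʳ)
    ⇝-refl (x > y)        h = ⇝-refl x (h ∘ >ˡ) ⟨>⟩ ⇝-refl y (h ∘ >ʳ)
    ⇝-refl (x < y)        h = ⇝-refl x (h ∘ <ˡ) ⟨<⟩ ⇝-refl y (h ∘ <ʳ)
    ⇝-refl (x △^⟨ i ⟩ y)  h = ⇝-refl x (h ∘ △ˡ) ⟨△⟩ ⇝-refl y (h ∘ △ʳ)
    ⇝-refl (x ▲^⟨ i ⟩ y)  h = ⇝-refl x (h ∘ ▲ˡ) ⟨▲⟩ ⇝-refl y (h ∘ ▲ʳ)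
    ⇝-refl (x ▷^⟨ i ⟩ y)  h = ⇝-refl x (h ∘ ▷ˡ) ⟨▷⟩ ⇝-refl y (h ∘ ▷ʳ)
    ⇝-refl (x ▶^⟨ i ⟩ y)  h = ⇝-refl x (h ∘ ▶ˡ) ⟨▶⟩ ⇝-refl y (h ∘ ▶ʳ)
    ⇝-refl (x ◁^⟨ i ⟩ y)  h = ⇝-refl x (h ∘ ◁ˡ) ⟨◁⟩ ⇝-refl y (h ∘ ◁ʳ)
    ⇝-refl (x ◀^⟨ i ⟩ y)  h = ⇝-refl x (h ∘ ◀ˡ) ⟨◀⟩ ⇝-refl y (h ∘ ◀ʳ)

    ⇝-occurs : ∀ {s} {u : Term s} → p ∶ x ⇝ x′ → u occursInStr x → Q u
    ⇝-occurs (keep k)   (leaf h) = k h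
    ⇝-occurs (repl k _) (leaf h) = k h
    ⇝-occurs (x ⟨⨾⟩ y) (⨾ˡ h) = ⇝-occurs x h
    ⇝-occurs (x ⟨⨾⟩ y) (⨾ʳ h) = ⇝-occurs y h
    ⇝-occurs (x ⟨>⟩ y) (>ˡ h) = ⇝-occurs x h
    ⇝-occurs (x ⟨>⟩ y) (>ʳ h) = ⇝-occurs y h
    ⇝-occurs (x ⟨<⟩ y) (<ˡ h) = ⇝-occurs x h
    ⇝-occurs (x ⟨<⟩ y) (<ʳ h) = ⇝-occurs y h
    ⇝-occurs (x ⟨△⟩ y) (△ˡ h) = ⇝-occurs x h
    ⇝-occurs (x ⟨△⟩ y) (△ʳ h) = ⇝-occurs y h
    ⇝-occurs (x ⟨▲⟩ y) (▲ˡ h) = ⇝-occurs x h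
    ⇝-occurs (x ⟨▲⟩ y) (▲ʳ h) = ⇝-occurs y h
    ⇝-occurs (x ⟨▷⟩ y) (▷ˡ h) = ⇝-occurs x h
    ⇝-occurs (x ⟨▷⟩ y) (▷ʳ h) = ⇝-occurs y h
    ⇝-occurs (x ⟨▶⟩ y) (▶ˡ h) = ⇝-occurs x h
    ⇝-occurs (x ⟨▶⟩ y) (▶ʳ h) = ⇝-occurs y h
    ⇝-occurs (x ⟨◁⟩ y) (◁ˡ h) = ⇝-occurs x h
    ⇝-occurs (x ⟨◁⟩ y) (◁ʳ h) = ⇝-occurs y h
    ⇝-occurs (x ⟨◀⟩ y) (◀ˡ h) = ⇝-occurs x h
    ⇝-occurs (x ⟨◀⟩ y) (◀ʳ h) = ⇝-occurs y h

    ⇝-off : off ∶ x ⇝ x′ → x ≡ x′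
    ⇝-off (keep _)   = refl
    ⇝-off (repl _ r) = ⊥-elim (live r)
    ⇝-off ⟨I⟩        = refl
    ⇝-off (x ⟨⨾⟩ y) = cong₂ _⨾_ (⇝-off x) (⇝-off y)
    ⇝-off (x ⟨>⟩ y) = cong₂ _>_ (⇝-off x) (⇝-off y)
    ⇝-off (x ⟨<⟩ y) = cong₂ _<_ (⇝-off x) (⇝-off y)
    ⇝-off (x ⟨△⟩ y) = cong₂ _△^⟨ _ ⟩_ (⇝-off x) (⇝-off y)
    ⇝-off (x ⟨▲⟩ y) = cong₂ _▲^⟨ _ ⟩_ (⇝-off x) (⇝-off y)
    ⇝-off (x ⟨▷⟩ y) = cong₂ _▷^⟨ _ ⟩_ (⇝-off x) (⇝-off y)
    ⇝-off (x ⟨▶⟩ y) = cong₂ _▶^⟨ _ ⟩_ (⇝-off x) (⇝-off y)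
    ⇝-off (x ⟨◁⟩ y) = cong₂ _◁^⟨ _ ⟩_ (⇝-off x) (⇝-off y)
    ⇝-off (x ⟨◀⟩ y) = cong₂ _◀^⟨ _ ⟩_ (⇝-off x) (⇝-off y)

    -- By typing, such a structure is a term, which `flexible` protects, or is headed by a
    -- connective that opens only in succedent position, so that its arguments are `off`.
    ⇝-rigid : {x x′ : Str t} → Rigid t → ant ∶ x ⇝ x′ → x ≡ x′
    ⇝-rigid t (keep _)   = refl
    ⇝-rigid t (repl _ r) = ⊥-elim (flexible t r)
    ⇝-rigid fnc (_⟨△⟩_ {i = ()} _ _)
    ⇝-rigid agt (_⟨△⟩_ {i = ()} _ _)
    ⇝-rigid fnc (_⟨▲⟩_ {i = ()} _ _)
    ⇝-rigid agt (_⟨▲⟩_ {i = ()} _ _)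
    ⇝-rigid t (x ⟨▷⟩ y) = cong₂ _▷^⟨ _ ⟩_ (⇝-off x) (⇝-off y)
    ⇝-rigid t (x ⟨▶⟩ y) = cong₂ _▶^⟨ _ ⟩_ (⇝-off x) (⇝-off y)
    ⇝-rigid t (x ⟨◁⟩ y) = cong₂ _◁^⟨ _ ⟩_ (⇝-off x) (⇝-off y)
    ⇝-rigid t (x ⟨◀⟩ y) = cong₂ _◀^⟨ _ ⟩_ (⇝-off x) (⇝-off y)

    -- Passing replacements from conclusions to premises.

    -- The map on derivations need not be the original rule: at a replaced principal term it is
    -- `left` or `right` instead.
    Lift : Sequent → Sequent → Set
    Lift S T′ = Σ[ S′ ∈ Sequent ] (S ⟶ S′ × (CutFreeDer S′ → CutFreeDer T′))

    -- Parameters have the same position in conclusion and premise, so their replacements are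
    -- reused, several times where the premise duplicates them. Only the swap-in rules and `balance`
    -- repeat a parameter in the conclusion; there the separate replacements must be shown to agree.
    lift : S /ˢ T → T ⟶ T′ → Lift S T′
    lift I-weakL (y ⟨⊢⟩ x)         = _ , ⟨I⟩ ⟨⊢⟩ x , apply I-weakL
    lift I-weakR (x ⟨⊢⟩ y)         = _ , x ⟨⊢⟩ ⟨I⟩ , apply I-weakR
    lift weak<R (y ⟨⊢⟩ z ⟨<⟩ x)    = _ , x ⟨⊢⟩ z , apply weak<R
    lift weak<L (x ⟨<⟩ z ⟨⊢⟩ y)    = _ , x ⟨⊢⟩ z , apply weak<L
    lift weak>R (y ⟨⊢⟩ x ⟨>⟩ z)    = _ , x ⟨⊢⟩ z , apply weak>R
    lift weak>L (z ⟨>⟩ x ⟨⊢⟩ y)    = _ , x ⟨⊢⟩ z , apply weak>L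
    lift contrL (x ⟨⊢⟩ y)          = _ , x ⟨⨾⟩ x ⟨⊢⟩ y , apply contrL
    lift contrR (y ⟨⊢⟩ x)          = _ , y ⟨⊢⟩ x ⟨⨾⟩ x , apply contrR
    lift exchL (x ⟨⨾⟩ y ⟨⊢⟩ z)     = _ , y ⟨⨾⟩ x ⟨⊢⟩ z , apply exchL
    lift exchR (z ⟨⊢⟩ y ⟨⨾⟩ x)     = _ , z ⟨⊢⟩ x ⟨⨾⟩ y , apply exchR
    lift assocL ((x ⟨⨾⟩ y) ⟨⨾⟩ z ⟨⊢⟩ w) = _ , x ⟨⨾⟩ (y ⟨⨾⟩ z) ⟨⊢⟩ w , apply assocL
    lift assocR (w ⟨⊢⟩ z ⟨⨾⟩ (y ⟨⨾⟩ x)) = _ , w ⟨⊢⟩ (z ⟨⨾⟩ y) ⟨⨾⟩ x , apply assocR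
    lift (nec△ i) (x ⟨△⟩ ⟨I⟩ ⟨⊢⟩ w) = _ , ⟨I⟩ ⟨⊢⟩ w , apply (nec△ i)
    lift (nec▲ i) (x ⟨▲⟩ ⟨I⟩ ⟨⊢⟩ w) = _ , ⟨I⟩ ⟨⊢⟩ w , apply (nec▲ i)
    lift (nec▷ i) (w ⟨⊢⟩ x ⟨▷⟩ ⟨I⟩) = _ , w ⟨⊢⟩ ⟨I⟩ , apply (nec▷ i)
    lift (nec▶ i) (w ⟨⊢⟩ x ⟨▶⟩ ⟨I⟩) = _ , w ⟨⊢⟩ ⟨I⟩ , apply (nec▶ i)
    lift (conj△ i) (y ⟨⨾⟩ (x ⟨△⟩ z) ⟨⊢⟩ w) = _ , x ⟨△⟩ ((x ⟨▲⟩ y) ⟨⨾⟩ z) ⟨⊢⟩ w , apply (conj△ i)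
    lift (conj▲ i) (y ⟨⨾⟩ (x ⟨▲⟩ z) ⟨⊢⟩ w) = _ , x ⟨▲⟩ ((x ⟨△⟩ y) ⟨⨾⟩ z) ⟨⊢⟩ w , apply (conj▲ i)
    lift (conj▷ i) (w ⟨⊢⟩ y ⟨⨾⟩ (x ⟨▷⟩ z)) = _ , w ⟨⊢⟩ x ⟨▷⟩ ((x ⟨▶⟩ y) ⟨⨾⟩ z) , apply (conj▷ i)
    lift (conj▶ i) (w ⟨⊢⟩ y ⟨⨾⟩ (x ⟨▶⟩ z)) = _ , w ⟨⊢⟩ x ⟨▶⟩ ((x ⟨▷⟩ y) ⟨⨾⟩ z) , apply (conj▶ i)
    lift (FS△ i) (x ⟨△⟩ (y ⟨>⟩ z) ⟨⊢⟩ w) = _ , (x ⟨▷⟩ y) ⟨>⟩ (x ⟨△⟩ z) ⟨⊢⟩ w , apply (FS△ i)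
    lift (FS▲ i) (x ⟨▲⟩ (y ⟨>⟩ z) ⟨⊢⟩ w) = _ , (x ⟨▶⟩ y) ⟨>⟩ (x ⟨▲⟩ z) ⟨⊢⟩ w , apply (FS▲ i)
    lift (FS▷ i) (w ⟨⊢⟩ x ⟨▷⟩ (y ⟨>⟩ z)) = _ , w ⟨⊢⟩ (x ⟨△⟩ y) ⟨>⟩ (x ⟨▷⟩ z) , apply (FS▷ i)
    lift (FS▶ i) (w ⟨⊢⟩ x ⟨▶⟩ (y ⟨>⟩ z)) = _ , w ⟨⊢⟩ (x ⟨▲⟩ y) ⟨>⟩ (x ⟨▶⟩ z) , apply (FS▶ i)
    lift (mon△ i) (x ⟨△⟩ (y ⟨⨾⟩ z) ⟨⊢⟩ w) = _ , (x ⟨△⟩ y) ⟨⨾⟩ (x ⟨△⟩ z) ⟨⊢⟩ w , apply (mon△ i)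
    lift (mon▲ i) (x ⟨▲⟩ (y ⟨⨾⟩ z) ⟨⊢⟩ w) = _ , (x ⟨▲⟩ y) ⟨⨾⟩ (x ⟨▲⟩ z) ⟨⊢⟩ w , apply (mon▲ i)
    lift (mon▷ i) (w ⟨⊢⟩ x ⟨▷⟩ (y ⟨⨾⟩ z)) = _ , w ⟨⊢⟩ (x ⟨▷⟩ y) ⟨⨾⟩ (x ⟨▷⟩ z) , apply (mon▷ i)
    lift (mon▶ i) (w ⟨⊢⟩ x ⟨▶⟩ (y ⟨⨾⟩ z)) = _ , w ⟨⊢⟩ (x ⟨▶⟩ y) ⟨⨾⟩ (x ⟨▶⟩ z) , apply (mon▶ i)
    lift swap-outL (a ⟨▲⟩ (f ⟨▲⟩ x) ⟨⊢⟩ y) = _ , (a ⟨▲⟩ f) ⟨▲⟩ (a ⟨▲⟩ x) ⟨⊢⟩ y , apply swap-outL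
    lift swap-outR (x ⟨⊢⟩ a ⟨▶⟩ (f ⟨▶⟩ y)) = _ , x ⟨⊢⟩ (a ⟨▲⟩ f) ⟨▶⟩ (a ⟨▶⟩ y) , apply swap-outR
    lift swap-inL ((a ⟨▲⟩ f) ⟨▲⟩ (a′ ⟨▲⟩ ((f′ ⟨△⟩ ⟨I⟩) ⟨⨾⟩ x)) ⟨⊢⟩ y)
      -- All copies stand in antecedent position, so each is unchanged and the premise can carry
      -- either one.
      with refl ← ⇝-rigid agt a | refl ← ⇝-rigid agt a′
         | refl ← ⇝-rigid fnc f | refl ← ⇝-rigid fnc f′ =
      _ , a ⟨▲⟩ (f ⟨▲⟩ x) ⟨⊢⟩ y , apply swap-inL
    lift swap-inR (x ⟨⊢⟩ (a ⟨▲⟩ f) ⟨▶⟩ (a′ ⟨▶⟩ ((f′ ⟨△⟩ ⟨I⟩) ⟨>⟩ y)))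
      with refl ← ⇝-rigid agt a | refl ← ⇝-rigid agt a′
         | refl ← ⇝-rigid fnc f | refl ← ⇝-rigid fnc f′ =
      _ , x ⟨⊢⟩ a ⟨▶⟩ (f ⟨▶⟩ y) , apply swap-inR
    lift balance (f ⟨△⟩ x ⟨⊢⟩ f′ ⟨▷⟩ y)
      with refl ← ⇝-rigid fnc f | refl ← ⇝-rigid fnc f′ = _ , x ⟨⊢⟩ y , apply balance

    -- A display postulate moves a heterogeneous connective only between sides where it is open, so
    -- `onlyAnt` and `onlySuc` compute to the positions that the premise requires.
    lift↓ : S // T → T ⟶ T′ → Lift S T′
    lift↓ I<R (⟨I⟩ ⟨⊢⟩ y ⟨<⟩ x)       = _ , x ⟨⊢⟩ y , apply↓ I<R
    lift↓ I<L (x ⟨<⟩ y ⟨⊢⟩ ⟨I⟩)       = _ , x ⟨⊢⟩ y , apply↓ I<L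
    lift↓ I>R (⟨I⟩ ⟨⊢⟩ x ⟨>⟩ y)       = _ , x ⟨⊢⟩ y , apply↓ I>R
    lift↓ I>L (y ⟨>⟩ x ⟨⊢⟩ ⟨I⟩)       = _ , x ⟨⊢⟩ y , apply↓ I>L
    lift↓ disp⨾<L (x ⟨⊢⟩ z ⟨<⟩ y)     = _ , x ⟨⨾⟩ y ⟨⊢⟩ z , apply↓ disp⨾<L
    lift↓ disp⨾<R (z ⟨<⟩ y ⟨⊢⟩ x)     = _ , z ⟨⊢⟩ x ⟨⨾⟩ y , apply↓ disp⨾<R
    lift↓ disp⨾>L (y ⟨⊢⟩ x ⟨>⟩ z)     = _ , x ⟨⨾⟩ y ⟨⊢⟩ z , apply↓ disp⨾>L
    lift↓ disp⨾>R (x ⟨>⟩ z ⟨⊢⟩ y)     = _ , z ⟨⊢⟩ x ⟨⨾⟩ y , apply↓ disp⨾>R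
    lift↓ (disp△▶ i) (y ⟨⊢⟩ x ⟨▶⟩ z)  = _ , x ⟨△⟩ y ⟨⊢⟩ z , apply↓ (disp△▶ i)
    lift↓ (disp▲▷ i) (y ⟨⊢⟩ x ⟨▷⟩ z)  = _ , x ⟨▲⟩ y ⟨⊢⟩ z , apply↓ (disp▲▷ i)
    lift↓ (disp△◀ i) (x ⟨⊢⟩ z ⟨◀⟩ y)  = _ , x ⟨△⟩ y ⟨⊢⟩ z , apply↓ (disp△◀ i)
    lift↓ (disp▲◁ i) (x ⟨⊢⟩ z ⟨◁⟩ y)  = _ , x ⟨▲⟩ y ⟨⊢⟩ z , apply↓ (disp▲◁ i)

    lift↑ : S // T → S ⟶ T′ → Lift T T′
    lift↑ I<R (x ⟨⊢⟩ y)               = _ , ⟨I⟩ ⟨⊢⟩ y ⟨<⟩ x , apply↑ I<R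
    lift↑ I<L (x ⟨⊢⟩ y)               = _ , x ⟨<⟩ y ⟨⊢⟩ ⟨I⟩ , apply↑ I<L
    lift↑ I>R (x ⟨⊢⟩ y)               = _ , ⟨I⟩ ⟨⊢⟩ x ⟨>⟩ y , apply↑ I>R
    lift↑ I>L (x ⟨⊢⟩ y)               = _ , y ⟨>⟩ x ⟨⊢⟩ ⟨I⟩ , apply↑ I>L
    lift↑ disp⨾<L (x ⟨⨾⟩ y ⟨⊢⟩ z)     = _ , x ⟨⊢⟩ z ⟨<⟩ y , apply↑ disp⨾<L
    lift↑ disp⨾<R (z ⟨⊢⟩ x ⟨⨾⟩ y)     = _ , z ⟨<⟩ y ⟨⊢⟩ x , apply↑ disp⨾<R
    lift↑ disp⨾>L (x ⟨⨾⟩ y ⟨⊢⟩ z)     = _ , y ⟨⊢⟩ x ⟨>⟩ z , apply↑ disp⨾>L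
    lift↑ disp⨾>R (z ⟨⊢⟩ x ⟨⨾⟩ y)     = _ , x ⟨>⟩ z ⟨⊢⟩ y , apply↑ disp⨾>R
    lift↑ (disp△▶ i) (x ⟨△⟩ y ⟨⊢⟩ z)  = _ , y ⟨⊢⟩ x ⟨▶⟩ z , apply↑ (disp△▶ i)
    lift↑ (disp▲▷ i) (x ⟨▲⟩ y ⟨⊢⟩ z)  = _ , y ⟨⊢⟩ x ⟨▷⟩ z , apply↑ (disp▲▷ i)
    lift↑ (disp△◀ i) (x ⟨△⟩ y ⟨⊢⟩ z)  = _ , x ⟨⊢⟩ z ⟨◀⟩ y , apply↑ (disp△◀ i)
    lift↑ (disp▲◁ i) (x ⟨▲⟩ y ⟨⊢⟩ z)  = _ , x ⟨⊢⟩ z ⟨◁⟩ y , apply↑ (disp▲◁ i)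

    liftᴳ↓ : g ≡ true → S //ᴳ T → T ⟶ T′ → Lift S T′
    liftᴳ↓ e grishinL ((x ⟨>⟩ y) ⟨⨾⟩ z ⟨⊢⟩ w) =
      _ , x ⟨>⟩ (y ⟨⨾⟩ z) ⟨⊢⟩ w , λ (d , c) → grishin↓ e grishinL d , grishin↓ c
    liftᴳ↓ e grishinR (w ⟨⊢⟩ (x ⟨>⟩ y) ⟨⨾⟩ z) =
      _ , w ⟨⊢⟩ x ⟨>⟩ (y ⟨⨾⟩ z) , λ (d , c) → grishin↓ e grishinR d , grishin↓ c

    liftᴳ↑ : g ≡ true → S //ᴳ T → S ⟶ T′ → Lift T T′
    liftᴳ↑ e grishinL (x ⟨>⟩ (y ⟨⨾⟩ z) ⟨⊢⟩ w) =
      _ , (x ⟨>⟩ y) ⟨⨾⟩ z ⟨⊢⟩ w , λ (d , c) → grishin↑ e grishinL d , grishin↑ c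
    liftᴳ↑ e grishinR (w ⟨⊢⟩ x ⟨>⟩ (y ⟨⨾⟩ z)) =
      _ , w ⟨⊢⟩ (x ⟨>⟩ y) ⟨⨾⟩ z , λ (d , c) → grishin↑ e grishinR d , grishin↑ c

    -- A replaced principal term leaves its immediate subterms untouched in the premise, while the
    -- parameters are replaced as usual. The result is exactly the principal inference that `left`
    -- or `right` consumes.
    lift₁ : S /ᵒ T → T ⟶ T′ → Lift S T′
    lift₁ ⊥R (x ⟨⊢⟩ keep k)       = _ , x ⟨⊢⟩ ⟨I⟩ , apply₁ ⊥R
    lift₁ ⊥R (x ⟨⊢⟩ repl k r)     = _ , x ⟨⊢⟩ ⟨I⟩ , right r ∘ ⊥R
    lift₁ ⊤L (keep k ⟨⊢⟩ x)       = _ , ⟨I⟩ ⟨⊢⟩ x , apply₁ ⊤L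
    lift₁ ⊤L (repl k r ⟨⊢⟩ x)     = _ , ⟨I⟩ ⟨⊢⟩ x , left r ∘ ⊤L
    lift₁ ∧L (keep k ⟨⊢⟩ z)       = _ , keep (k ∘ ∧ˡ) ⟨⨾⟩ keep (k ∘ ∧ʳ) ⟨⊢⟩ z , apply₁ ∧L
    lift₁ ∧L (repl k r ⟨⊢⟩ z)     = _ , keep (k ∘ ∧ˡ) ⟨⨾⟩ keep (k ∘ ∧ʳ) ⟨⊢⟩ z , left r ∘ ∧L
    lift₁ ∨R (z ⟨⊢⟩ keep k)       = _ , z ⟨⊢⟩ keep (k ∘ ∨ˡ) ⟨⨾⟩ keep (k ∘ ∨ʳ) , apply₁ ∨R
    lift₁ ∨R (z ⟨⊢⟩ repl k r)     = _ , z ⟨⊢⟩ keep (k ∘ ∨ˡ) ⟨⨾⟩ keep (k ∘ ∨ʳ) , right r ∘ ∨R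
    lift₁ ⇐R (z ⟨⊢⟩ keep k)       = _ , z ⟨⊢⟩ keep (k ∘ ⇐ˡ) ⟨<⟩ keep (k ∘ ⇐ʳ) , apply₁ ⇐R
    lift₁ ⇐R (z ⟨⊢⟩ repl k r)     = _ , z ⟨⊢⟩ keep (k ∘ ⇐ˡ) ⟨<⟩ keep (k ∘ ⇐ʳ) , right r ∘ ⇐R
    lift₁ ≺L (keep k ⟨⊢⟩ z)       = _ , keep (k ∘ ≺ˡ) ⟨<⟩ keep (k ∘ ≺ʳ) ⟨⊢⟩ z , apply₁ ≺L
    lift₁ ≺L (repl k r ⟨⊢⟩ z)     = _ , keep (k ∘ ≺ˡ) ⟨<⟩ keep (k ∘ ≺ʳ) ⟨⊢⟩ z , left r ∘ ≺L
    lift₁ ⇒R (z ⟨⊢⟩ keep k)       = _ , z ⟨⊢⟩ keep (k ∘ ⇒ˡ) ⟨>⟩ keep (k ∘ ⇒ʳ) , apply₁ ⇒R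
    lift₁ ⇒R (z ⟨⊢⟩ repl k r)     = _ , z ⟨⊢⟩ keep (k ∘ ⇒ˡ) ⟨>⟩ keep (k ∘ ⇒ʳ) , right r ∘ ⇒R
    lift₁ ≻L (keep k ⟨⊢⟩ z)       = _ , keep (k ∘ ≻ˡ) ⟨>⟩ keep (k ∘ ≻ʳ) ⟨⊢⟩ z , apply₁ ≻L
    lift₁ ≻L (repl k r ⟨⊢⟩ z)     = _ , keep (k ∘ ≻ˡ) ⟨>⟩ keep (k ∘ ≻ʳ) ⟨⊢⟩ z , left r ∘ ≻L
    lift₁ (△L i) (keep k ⟨⊢⟩ z)   = _ , keep (k ∘ △ˡ) ⟨△⟩ keep (k ∘ △ʳ) ⟨⊢⟩ z , apply₁ (△L i)
    lift₁ (△L i) (repl k r ⟨⊢⟩ z) = _ , keep (k ∘ △ˡ) ⟨△⟩ keep (k ∘ △ʳ) ⟨⊢⟩ z , left r ∘ △L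
    lift₁ (▲L i) (keep k ⟨⊢⟩ z)   = _ , keep (k ∘ ▲ˡ) ⟨▲⟩ keep (k ∘ ▲ʳ) ⟨⊢⟩ z , apply₁ (▲L i)
    lift₁ (▲L i) (repl k r ⟨⊢⟩ z) = _ , keep (k ∘ ▲ˡ) ⟨▲⟩ keep (k ∘ ▲ʳ) ⟨⊢⟩ z , left r ∘ ▲L
    lift₁ (▷R i) (z ⟨⊢⟩ keep k)   = _ , z ⟨⊢⟩ keep (k ∘ ▷ˡ) ⟨▷⟩ keep (k ∘ ▷ʳ) , apply₁ (▷R i)
    lift₁ (▷R i) (z ⟨⊢⟩ repl k r) = _ , z ⟨⊢⟩ keep (k ∘ ▷ˡ) ⟨▷⟩ keep (k ∘ ▷ʳ) , right r ∘ ▷R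
    lift₁ (▶R i) (z ⟨⊢⟩ keep k)   = _ , z ⟨⊢⟩ keep (k ∘ ▶ˡ) ⟨▶⟩ keep (k ∘ ▶ʳ) , apply₁ (▶R i)
    lift₁ (▶R i) (z ⟨⊢⟩ repl k r) = _ , z ⟨⊢⟩ keep (k ∘ ▶ˡ) ⟨▶⟩ keep (k ∘ ▶ʳ) , right r ∘ ▶R

    Lift₂ : Sequent → Sequent → Sequent → Set
    Lift₂ S₁ S₂ T′ = Σ[ S₁′ ∈ Sequent ] Σ[ S₂′ ∈ Sequent ]
      (S₁ ⟶ S₁′ × S₂ ⟶ S₂′ × (CutFreeDer S₁′ → CutFreeDer S₂′ → CutFreeDer T′))

    lift₂ : S₁ , S₂ /ᵒ T → T ⟶ T′ → Lift₂ S₁ S₂ T′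
    lift₂ ∧R (x ⟨⨾⟩ y ⟨⊢⟩ keep k) =
      _ , _ , x ⟨⊢⟩ keep (k ∘ ∧ˡ) , y ⟨⊢⟩ keep (k ∘ ∧ʳ) , apply₂ ∧R
    lift₂ ∧R (x ⟨⨾⟩ y ⟨⊢⟩ repl k r) =
      _ , _ , x ⟨⊢⟩ keep (k ∘ ∧ˡ) , y ⟨⊢⟩ keep (k ∘ ∧ʳ) , λ d e → right r (∧R d e)
    lift₂ ∨L (keep k ⟨⊢⟩ x ⟨⨾⟩ y) =
      _ , _ , keep (k ∘ ∨ˡ) ⟨⊢⟩ x , keep (k ∘ ∨ʳ) ⟨⊢⟩ y , apply₂ ∨L
    lift₂ ∨L (repl k r ⟨⊢⟩ x ⟨⨾⟩ y) =
      _ , _ , keep (k ∘ ∨ˡ) ⟨⊢⟩ x , keep (k ∘ ∨ʳ) ⟨⊢⟩ y , λ d e → left r (∨L d e)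
    lift₂ ⇐L (keep k ⟨⊢⟩ y ⟨<⟩ x) =
      _ , _ , keep (k ∘ ⇐ˡ) ⟨⊢⟩ y , x ⟨⊢⟩ keep (k ∘ ⇐ʳ) , apply₂ ⇐L
    lift₂ ⇐L (repl k r ⟨⊢⟩ y ⟨<⟩ x) =
      _ , _ , keep (k ∘ ⇐ˡ) ⟨⊢⟩ y , x ⟨⊢⟩ keep (k ∘ ⇐ʳ) , λ d e → left r (⇐L d e)
    lift₂ ≺R (y ⟨<⟩ x ⟨⊢⟩ keep k) =
      _ , _ , y ⟨⊢⟩ keep (k ∘ ≺ˡ) , keep (k ∘ ≺ʳ) ⟨⊢⟩ x , apply₂ ≺R
    lift₂ ≺R (y ⟨<⟩ x ⟨⊢⟩ repl k r) =
      _ , _ , y ⟨⊢⟩ keep (k ∘ ≺ˡ) , keep (k ∘ ≺ʳ) ⟨⊢⟩ x , λ d e → right r (≺R d e)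
    lift₂ ⇒L (keep k ⟨⊢⟩ x ⟨>⟩ y) =
      _ , _ , x ⟨⊢⟩ keep (k ∘ ⇒ˡ) , keep (k ∘ ⇒ʳ) ⟨⊢⟩ y , apply₂ ⇒L
    lift₂ ⇒L (repl k r ⟨⊢⟩ x ⟨>⟩ y) =
      _ , _ , x ⟨⊢⟩ keep (k ∘ ⇒ˡ) , keep (k ∘ ⇒ʳ) ⟨⊢⟩ y , λ d e → left r (⇒L d e)
    lift₂ ≻R (x ⟨>⟩ y ⟨⊢⟩ keep k) =
      _ , _ , keep (k ∘ ≻ˡ) ⟨⊢⟩ x , y ⟨⊢⟩ keep (k ∘ ≻ʳ) , apply₂ ≻R
    lift₂ ≻R (x ⟨>⟩ y ⟨⊢⟩ repl k r) =
      _ , _ , keep (k ∘ ≻ˡ) ⟨⊢⟩ x , y ⟨⊢⟩ keep (k ∘ ≻ʳ) , λ d e → right r (≻R d e)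
    lift₂ (△R i) (x ⟨△⟩ y ⟨⊢⟩ keep k) =
      _ , _ , x ⟨⊢⟩ keep (k ∘ △ˡ) , y ⟨⊢⟩ keep (k ∘ △ʳ) , apply₂ (△R i)
    lift₂ (△R i) (x ⟨△⟩ y ⟨⊢⟩ repl k r) =
      _ , _ , x ⟨⊢⟩ keep (k ∘ △ˡ) , y ⟨⊢⟩ keep (k ∘ △ʳ) , λ d e → right r (△R d e)
    lift₂ (▲R i) (x ⟨▲⟩ y ⟨⊢⟩ keep k) =
      _ , _ , x ⟨⊢⟩ keep (k ∘ ▲ˡ) , y ⟨⊢⟩ keep (k ∘ ▲ʳ) , apply₂ (▲R i)
    lift₂ (▲R i) (x ⟨▲⟩ y ⟨⊢⟩ repl k r) =
      _ , _ , x ⟨⊢⟩ keep (k ∘ ▲ˡ) , y ⟨⊢⟩ keep (k ∘ ▲ʳ) , λ d e → right r (▲R d e)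
    lift₂ (▷L i) (keep k ⟨⊢⟩ x ⟨▷⟩ y) =
      _ , _ , x ⟨⊢⟩ keep (k ∘ ▷ˡ) , keep (k ∘ ▷ʳ) ⟨⊢⟩ y , apply₂ (▷L i)
    lift₂ (▷L i) (repl k r ⟨⊢⟩ x ⟨▷⟩ y) =
      _ , _ , x ⟨⊢⟩ keep (k ∘ ▷ˡ) , keep (k ∘ ▷ʳ) ⟨⊢⟩ y , λ d e → left r (▷L d e)
    lift₂ (▶L i) (keep k ⟨⊢⟩ x ⟨▶⟩ y) =
      _ , _ , x ⟨⊢⟩ keep (k ∘ ▶ˡ) , keep (k ∘ ▶ʳ) ⟨⊢⟩ y , apply₂ (▶L i)
    lift₂ (▶L i) (repl k r ⟨⊢⟩ x ⟨▶⟩ y) =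
      _ , _ , x ⟨⊢⟩ keep (k ∘ ▶ˡ) , keep (k ∘ ▶ʳ) ⟨⊢⟩ y , λ d e → left r (▶L d e)

    -- Axioms under replacement.

    -- With the atom itself kept, only the functional structures of the prefix can change, and the
    -- axiom admits any of those.
    AtomL-⇝ : ∀ {p X X′} → (∀ {z} → ¬ Replaces ant (prop p) z) →
              AtomL p X → ant ∶ X ⇝ X′ → AtomL p X′
    AtomL-⇝ n base  (keep _)   = base
    AtomL-⇝ n base  (repl _ r) = ⊥-elim (n r)
    AtomL-⇝ n (△ A) (_ ⟨△⟩ x)  = △ (AtomL-⇝ n A x)
    AtomL-⇝ n (▲ A) (_ ⟨▲⟩ x)  = ▲ (AtomL-⇝ n A x)

    -- Displaying the replaced atom moves the prefix of the axiom to the other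
    -- side of the turnstile, where it again forms an atom axiom.
    atomˡ : ∀ {p X X′ Y} → AtomL p X → ant ∶ X ⇝ X′ → AtomR p Y → CutFreeDer (X′ ⊢ Y)
    atomˡ base  (keep _)   B = ax (atom base B)
    atomˡ base  (repl _ r) B = left r (atom B)
    atomˡ (△ A) (_ ⟨△⟩ x)  B = apply↑ (disp△▶ i0) (atomˡ A x (▶ B))
    atomˡ (▲ A) (_ ⟨▲⟩ x)  B = apply↑ (disp▲▷ i0) (atomˡ A x (▷ B))

    atomʳ : ∀ {p X X′ Y Y′} → AtomL p X → ant ∶ X ⇝ X′ →
            AtomR p Y → suc ∶ Y ⇝ Y′ → CutFreeDer (X′ ⊢ Y′)
    atomʳ A x base  (keep _)   = atomˡ A x base
    -- The whole right prefix has moved left, and `oneSided` guarantees that the left atom is kept,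
    -- so the left side still has axiom shape.
    atomʳ A x base  (repl _ r) = right r (atom (AtomL-⇝ (oneSided r) A x))
    atomʳ A x (▷ B) (f ⟨▷⟩ y)  = apply↓ (disp▲▷ i0) (atomʳ (▲ A) (f ⟨▲⟩ x) B y)
    atomʳ A x (▶ B) (f ⟨▶⟩ y)  = apply↓ (disp△▶ i0) (atomʳ (△ A) (f ⟨△⟩ x) B y)

    replaceAxiom : Axiom T → T ⟶ T′ → CutFreeDer T′
    replaceAxiom agt-ax (keep _   ⟨⊢⟩ keep _)   = ax agt-ax
    replaceAxiom agt-ax (repl _ r ⟨⊢⟩ _)        = ⊥-elim (flexible agt r)
    replaceAxiom agt-ax (keep _   ⟨⊢⟩ repl _ r) = ⊥-elim (flexible agt r)
    replaceAxiom fnc-ax (keep _   ⟨⊢⟩ keep _)   = ax fnc-ax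
    replaceAxiom fnc-ax (repl _ r ⟨⊢⟩ _)        = ⊥-elim (flexible fnc r)
    replaceAxiom fnc-ax (keep _   ⟨⊢⟩ repl _ r) = ⊥-elim (flexible fnc r)
    replaceAxiom ⊥-ax   (keep _   ⟨⊢⟩ ⟨I⟩)      = ax ⊥-ax
    replaceAxiom ⊥-ax   (repl _ r ⟨⊢⟩ ⟨I⟩)      = left r ⊥L
    replaceAxiom ⊤-ax   (⟨I⟩ ⟨⊢⟩ keep _)        = ax ⊤-ax
    replaceAxiom ⊤-ax   (⟨I⟩ ⟨⊢⟩ repl _ r)      = right r ⊤R
    replaceAxiom (atom A B) (x ⟨⊢⟩ y)           = atomʳ A x B y

    -- Replacement along a whole derivation.

    -- Recursion on the given derivation alone: the cuts needed at principal occurrences are hidden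
    -- in `left` and `right`.
    replace : {d : Der g T} → CutFree d → T ⟶ T′ → CutFreeDer T′
    replace (axiom {A = A}) s = replaceAxiom A s
    replace (struct {R = R} c) s with _ , s′ , f ← lift R s = f (replace c s′)
    replace (struct↓ {R = R} c) s with _ , s′ , f ← lift↓ R s = f (replace c s′)
    replace (struct↑ {R = R} c) s with _ , s′ , f ← lift↑ R s = f (replace c s′)
    replace (grishin↓ {e = e} {R} c) s with _ , s′ , f ← liftᴳ↓ e R s = f (replace c s′)
    replace (grishin↑ {e = e} {R} c) s with _ , s′ , f ← liftᴳ↑ e R s = f (replace c s′)
    replace (logic₁ {R = R} c) s with _ , s′ , f ← lift₁ R s = f (replace c s′)
    replace (logic₂ {R = R} c c′) s with _ , _ , s₁ , s₂ , f ← lift₂ R s =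
      f (replace c s₁) (replace c′ s₂)

    -- Being the source of some `⟶` forces `Q` on every term of a sequent, so this carries `Q` from
    -- the end sequent to all sequents above it.
    track : {d : Der g T} → CutFree d → T ⟶ T′ → S appearsIn d → Σ[ S′ ∈ Sequent ] S ⟶ S′
    track c s here = _ , s
    track (struct {R = R} c) s (struct h) with _ , s′ , _ ← lift R s = track c s′ h
    track (struct↓ {R = R} c) s (struct↓ h) with _ , s′ , _ ← lift↓ R s = track c s′ h
    track (struct↑ {R = R} c) s (struct↑ h) with _ , s′ , _ ← lift↑ R s = track c s′ h
    track (grishin↓ {e = e} {R} c) s (grishin↓ h) with _ , s′ , _ ← liftᴳ↓ e R s = track c s′ h
    track (grishin↑ {e = e} {R} c) s (grishin↑ h) with _ , s′ , _ ← liftᴳ↑ e R s = track c s′ h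
    track (logic₁ {R = R} c) s (logic₁ h) with _ , s′ , _ ← lift₁ R s = track c s′ h
    track (logic₂ {R = R} c _) s (logic₂ˡ h) with _ , _ , s₁ , _ ← lift₂ R s = track c s₁ h
    track (logic₂ {R = R} _ c) s (logic₂ʳ h) with _ , _ , _ , s₂ , _ ← lift₂ R s = track c s₂ h

    track-occurs : ∀ {s} {u : Term s} {d : Der g T} →
                   CutFree d → T ⟶ T′ → S appearsIn d → u occursIn S → Q u
    track-occurs c s h o with track c s h | o
    ... | _ , (l ⟨⊢⟩ r) | inj₁ o = ⇝-occurs l o
    ... | _ , (l ⟨⊢⟩ r) | inj₂ o = ⇝-occurs r o

  -- The concrete replacements.

  -- A singleton family: matching `only` identifies position, type, term and structure together, and
  -- a wrong position is refuted by an absurd pattern.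
  data Only (p : Position) (a : Term t) (z : Str t) : Position → ∀ {s} → Term s → Str s → Set where
    only : Only p a z p a z

  onlyAnt-replacement : {a : Term t} {x : Str t} → ¬ Rigid t →
    (∀ {y} → LeftPrincipal a y → CutFreeDer (x ⊢ y)) → Replacement
  onlyAnt-replacement {a = a} {x} nr h = record
    { Replaces = Only ant a x
    ; live     = λ ()
    ; flexible = λ { rt only → nr rt }
    ; oneSided = λ ()
    ; right    = λ ()
    ; left     = λ { only → h }
    }

  onlySuc-replacement : {a : Term t} {y : Str t} → ¬ Rigid t →
    (∀ {x} → RightPrincipal a x → CutFreeDer (x ⊢ y)) → Replacement
  onlySuc-replacement {a = a} {y} nr h = record
    { Replaces = Only suc a y
    ; live     = λ ()
    ; flexible = λ { rt only → nr rt }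
    ; oneSided = λ { only () }
    ; right    = λ { only → h }
    ; left     = λ ()
    }

  -- Reduces tracing to bookkeeping of occurring terms, as the subterm property requires.
  no-replacement : Replacement
  no-replacement = record
    { Replaces = λ _ _ _ → ⊥
    ; live     = λ ()
    ; flexible = λ _ ()
    ; oneSided = λ ()
    ; right    = λ ()
    ; left     = λ ()
    }

  -- Admissibility of cut.

  -- The second pass starts afresh at each right-principal occurrence met by the first, inserting
  -- the structure found there into the derivation of `⌜ a ⌝ ⊢ y`.
  cut-by-reduction : {a : Term t} → ¬ Rigid t →
    (∀ {x y} → RightPrincipal a x → LeftPrincipal a y → CutFreeDer (x ⊢ y)) →
    CutFreeDer (x ⊢ ⌜ a ⌝) → CutFreeDer (⌜ a ⌝ ⊢ y) → CutFreeDer (x ⊢ y)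
  cut-by-reduction {a = a} nr reduce (_ , c) (_ , c′) =
    replaceʳ c (λ rp → replaceˡ c′ (reduce rp))
    where
    trivial : ∀ {s} → Term s → Set
    trivial _ = ⊤

    replaceˡ : ∀ {x y} {d : Der g (⌜ a ⌝ ⊢ y)} → CutFree d →
      (∀ {y} → LeftPrincipal a y → CutFreeDer (x ⊢ y)) → CutFreeDer (x ⊢ y)
    replaceˡ {x} {y} c h = replace c (repl (λ _ → tt) only ⟨⊢⟩ ⇝-refl y (λ _ → tt))
      where open Tracing (onlyAnt-replacement nr h) trivial

    replaceʳ : ∀ {x y} {d : Der g (x ⊢ ⌜ a ⌝)} → CutFree d →
      (∀ {x} → RightPrincipal a x → CutFreeDer (x ⊢ y)) → CutFreeDer (x ⊢ y)
    replaceʳ {x} {y} c h = replace c (⇝-refl x (λ _ → tt) ⟨⊢⟩ repl (λ _ → tt) only)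
      where open Tracing (onlySuc-replacement nr h) trivial

  -- No `Idx` has result type `Fnc` or `Ag`, so no rule for `△` or `▲` and no display step can end
  -- with such a term on the right. Only the axiom remains.
  rigid-term : {x : Str t} {a : Term t} {d : Der g (x ⊢ ⌜ a ⌝)} →
               Rigid t → CutFree d → x ≡ ⌜ a ⌝
  rigid-term fnc (axiom {A = fnc-ax}) = refl
  rigid-term agt (axiom {A = agt-ax}) = refl
  rigid-term fnc (struct↑ {R = disp△▶ ()} _)
  rigid-term fnc (struct↑ {R = disp▲▷ ()} _)
  rigid-term fnc (struct↑ {R = disp△◀ ()} _)
  rigid-term fnc (struct↑ {R = disp▲◁ ()} _)
  rigid-term agt (struct↑ {R = disp△▶ ()} _)
  rigid-term agt (struct↑ {R = disp▲▷ ()} _)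
  rigid-term agt (struct↑ {R = disp△◀ ()} _)
  rigid-term agt (struct↑ {R = disp▲◁ ()} _)
  rigid-term fnc (logic₁ {R = △L ()} _)
  rigid-term fnc (logic₁ {R = ▲L ()} _)
  rigid-term agt (logic₁ {R = △L ()} _)
  rigid-term agt (logic₁ {R = ▲L ()} _)
  rigid-term fnc (logic₂ {R = △R ()} _ _)
  rigid-term fnc (logic₂ {R = ▲R ()} _ _)
  rigid-term agt (logic₂ {R = △R ()} _ _)
  rigid-term agt (logic₂ {R = ▲R ()} _ _)

  cut-rigid : {a : Term t} → Rigid t →
    CutFreeDer (x ⊢ ⌜ a ⌝) → CutFreeDer (⌜ a ⌝ ⊢ y) → CutFreeDer (x ⊢ y)
  cut-rigid rt (_ , c) e with refl ← rigid-term rt c = e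

  mutual
    -- Terminates on the structure of the cut term: `reduce` cuts only on immediate subterms.
    cut-admissible : (a : Term t) →
      CutFreeDer (x ⊢ ⌜ a ⌝) → CutFreeDer (⌜ a ⌝ ⊢ y) → CutFreeDer (x ⊢ y)
    cut-admissible {Fm}  a = cut-by-reduction (λ ()) (reduce a)
    cut-admissible {Act} a = cut-by-reduction (λ ()) (reduce a)
    cut-admissible {Fnc} a = cut-rigid fnc
    cut-admissible {Ag}  a = cut-rigid agt

    -- Each immediate subterm is displayed alone on one side, cut there, and the inverse postulates
    -- restore the conclusion. At `i3` the display passes through the virtual adjoints.
    reduce : (a : Term t) → RightPrincipal a x → LeftPrincipal a y → CutFreeDer (x ⊢ y)
    -- The left prefix of one atom axiom and the right prefix of the other form an atom axiom again.
    reduce (prop p) (atom A) (atom B) = ax (atom A B)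
    reduce ⊥ᶠ (⊥R d) ⊥L     = d
    reduce ⊤ᶠ ⊤R     (⊤L e) = e
    reduce (A ∧ B) (∧R d₁ d₂) (∧L e) =
      apply↑ disp⨾>L (cut-admissible B d₂
        (apply↓ disp⨾>L (apply↑ disp⨾<L (cut-admissible A d₁ (apply↓ disp⨾<L e)))))
    reduce (A ∨ B) (∨R d) (∨L e₁ e₂) =
      apply↑ disp⨾>R (cut-admissible B
        (apply↓ disp⨾>R (apply↑ disp⨾<R (cut-admissible A (apply↓ disp⨾<R d) e₁))) e₂)
    reduce (A ⇒ B) (⇒R d) (⇒L e₁ e₂) =
      apply↓ disp⨾>L (apply↑ disp⨾<L (cut-admissible A e₁
        (apply↓ disp⨾<L (cut-admissible B (apply↑ disp⨾>L d) e₂))))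
    reduce (B ⇐ A) (⇐R d) (⇐L e₁ e₂) =
      apply↓ disp⨾<L (apply↑ disp⨾>L (cut-admissible A e₂
        (apply↓ disp⨾>L (cut-admissible B (apply↑ disp⨾<L d) e₁))))
    reduce (A ≻ B) (≻R d₁ d₂) (≻L e) =
      apply↓ disp⨾>R (apply↑ disp⨾<R (cut-admissible A
        (apply↓ disp⨾<R (cut-admissible B d₂ (apply↑ disp⨾>R e))) d₁))
    reduce (B ≺ A) (≺R d₁ d₂) (≺L e) =
      apply↓ disp⨾<R (apply↑ disp⨾>R (cut-admissible A
        (apply↓ disp⨾>R (cut-admissible B d₁ (apply↑ disp⨾<R e))) d₂))
    reduce (a △⟨ i ⟩ b) (△R d₁ d₂) (△L e) =
      apply↑ (disp△▶ i) (cut-admissible b d₂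
        (apply↓ (disp△▶ i) (apply↑ (disp△◀ i) (cut-admissible a d₁ (apply↓ (disp△◀ i) e)))))
    reduce (a ▲⟨ i ⟩ b) (▲R d₁ d₂) (▲L e) =
      apply↑ (disp▲▷ i) (cut-admissible b d₂
        (apply↓ (disp▲▷ i) (apply↑ (disp▲◁ i) (cut-admissible a d₁ (apply↓ (disp▲◁ i) e)))))
    reduce (a ▷⟨ i ⟩ B) (▷R d) (▷L e₁ e₂) =
      apply↓ (disp▲▷ i) (apply↑ (disp▲◁ i) (cut-admissible a e₁
        (apply↓ (disp▲◁ i) (cut-admissible B (apply↑ (disp▲▷ i) d) e₂))))
    reduce (a ▶⟨ i ⟩ B) (▶R d) (▶L e₁ e₂) =
      apply↓ (disp△▶ i) (apply↑ (disp△◀ i) (cut-admissible a e₁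
        (apply↓ (disp△◀ i) (cut-admissible B (apply↑ (disp△▶ i) d) e₂))))

  -- Cut elimination and the subterm property.

  cut-elimination : Der g S → CutFreeDer S
  cut-elimination (axiom A)        = ax A
  cut-elimination (cut a d e)      = cut-admissible a (cut-elimination d) (cut-elimination e)
  cut-elimination (struct R d)     = apply R (cut-elimination d)
  cut-elimination (struct↓ R d)    = apply↓ R (cut-elimination d)
  cut-elimination (struct↑ R d)    = apply↑ R (cut-elimination d)
  cut-elimination (grishin↓ e R d) with d′ , c ← cut-elimination d = grishin↓ e R d′ , grishin↓ c
  cut-elimination (grishin↑ e R d) with d′ , c ← cut-elimination d = grishin↑ e R d′ , grishin↑ c
  cut-elimination (logic₁ R d)     = apply₁ R (cut-elimination d)
  cut-elimination (logic₂ R d e)   = apply₂ R (cut-elimination d) (cut-elimination e)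

  -- Tracing the identity replacement with `Q` taken as occurrence in the end sequent.
  subterm-property : {d : Der g T} → CutFree d → HasSubtermProperty d
  subterm-property {T = x ⊢ y} c h u o =
    -- Occurrence already includes occurrence inside a larger term, so `u` itself serves as the
    -- witness.
    _ , u , track-occurs c (⇝-refl x inj₁ ⟨⊢⟩ ⇝-refl y inj₂) h o , refl
    where open Tracing no-replacement (_occursIn (x ⊢ y))

mainTheorem2 : (AtProp AtFnc AtAg : Set) →
    let open DynamicCalculus AtProp AtFnc AtAg in
    (grishin : Bool) (S : Sequent) → Der grishin S →
    Σ[ d ∈ Der grishin S ] (CutFree d × HasSubtermProperty d)
mainTheorem2 AtProp AtFnc AtAg grishin S d =
  let d′ , c = cut-elimination d in d′ , c , subterm-property c
  where open CutElimination AtProp AtFnc AtAg grishin
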